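{- Let $T_0$ be any initial BST on $\{1,\dots,n\}$. For every $n\ge 2$ there exist query sequences $X\in[n]^m$ such that $$\mathrm{cost}(GF,X,T_0)-\mathrm{cost}(OPT,X,T_0)=\Omega(m\cdot\lg\lg n),$$ where the constant hidden in $\Omega$ is independent of $n$ and $m$. Among these sequences there is one whose length is $m=n^{\Theta(\lg\lg n/\lg\lg\lg n)}$.
   Context: $\lg$ is the base-2 logarithm. Binary search tree model. Keys are $\{1,\dots,n\}$. A query sequence is $X=[x_1,\dots,x_m]\in[n]^m$ and $T_0$ is an initial binary search tree (BST) on the keys. An algorithm $A$ serves $x_1,\dots,x_m$ in order. Before serving $x_t$ it holds a BST $T_{t-1}$; it searches $x_t$ from the root and may then restructure the tree by rotations into $T_t$. Let $P_t$ be the set of nodes on the root-to-$x_t$ path of $T_{t-1}$, and let $U_t$ be the node set of the minimal subtree containing all edges rotated in transforming $T_{t-1}$ into $T_t$. The cost at time $t$ is $|P_t\cup U_t|$. $\mathrm{cost}(A,X,T_0)$ is the sum of these costs over $t=1,\dots,m$. $OPT$ denotes an algorithm of minimum cost on $(X,T_0)$ that knows all of $X$ in advance. Greedy Future ($GF$). After finding $x_t$ in $T_{t-1}$, let $v_1<\dots<v_k$ be the keys on the root-to-$x_t$ path, set $v_0=-\infty$ and $v_{k+1}=+\infty$, and let $R_0,\dots,R_k$ be the subtrees hanging off this path. For each $i$, $\tau(v_i)$ is the smallest $s>t$ with $x_s\in(v_{i-1},v_{i+1})$, or $+\infty$ if there is none. $GF$ rearranges $v_1,\dots,v_k$ as a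 treap: a BST in key order and a heap in $\tau$, with the smallest $\tau$ at the top. Ties in $\tau$ are broken in favor of the node of smaller depth in $T_{t-1}$. It then reattaches $R_0,\dots,R_k$ unchanged at their unique positions, giving $T_t$. -}

module Defs where

open import Data.Empty using (⊥-elim)
open import Data.Fin using (Fin; _<_)
open import Data.Fin.Properties using (_<?_; <-cmp; <-asym; <-irrefl)
open import Data.Fin.Subset using (Subset; _∈_; _⊆_; _∪_; ∣_∣; ⁅_⁆; ⊥; ⋃)
open import Data.Fin.Subset.Properties
  using (∉⊥; x∈⁅x⁆; x∈⁅y⁆⇒x≡y; x∈p∪q⁺; x∈p∪q⁻)
open import Data.List using (List; []; _∷_; filter; head; last; length; takeWhile; cartesianProductWith)
import Data.List.Membership.Propositional as L
open import Data.List.Membership.Propositional.Properties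
  using (∈-cartesianProductWith⁺; ∈-cartesianProductWith⁻)
open import Data.List.Relation.Unary.Any using (here; there)
open import Data.Maybe using (maybe)
open import Data.Nat as ℕ using (ℕ; _+_; _*_; _∸_; _^_; _≤_)
open import Data.Nat.Induction using (<-rec)
open import Data.Nat.Logarithm using (⌈log₂_⌉)
import Data.Nat.Properties as ℕ
open import Data.Product using (Σ; ∃-syntax; _×_; _,_; proj₁; proj₂)
open import Data.Product.Relation.Binary.Lex.NonStrict using (×-decTotalOrder)
open import Data.Sum using (_⊎_; inj₁; inj₂)
open import Data.Tree.Binary using (Tree; leaf; node; foldr; module Infix)
open import Data.Tree.Binary.Relation.Unary.All using (All; leaf; node)
open import Data.Unit using (tt) renaming (⊤ to Unit)
open import Data.Vec as Vec using (Vec; []; _∷_)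
open import Function using (id; _∘_)
open import Level using (0ℓ)
open import Relation.Binary using (DecTotalOrder; tri<; tri≈; tri>)
open import Relation.Binary.Construct.Add.Extrema.Strict using (<±-dec)
open import Relation.Binary.Construct.Closure.ReflexiveTransitive
  using (Star; ε; _◅_; _◅◅_; gmap; reverse)
open import Relation.Binary.Construct.Closure.Symmetric using (SymClosure; fwd; bwd)
open import Relation.Binary.PropositionalEquality using (_≡_; refl; cong; subst)
open import Relation.Nullary using (¬_; Dec; yes; no; ¬?)
open import Relation.Nullary.Construct.Add.Extrema using (_±; ⊥±; ⊤±; [_])
open import Relation.Nullary.Decidable using (_×-dec_)

private variable
  N L : Set
  m n : ℕ

------------------------------------------------------------------------
-- Binary search trees

-- The key set {1,…,n} is represented by Fin n.
KeyTree : ℕ → Set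
KeyTree n = Tree (Fin n) Unit

data _∈ₜ_ {N L : Set} (x : N) : Tree N L → Set where
  here    : ∀ {l r} → x ∈ₜ node l x r
  inleft  : ∀ {l k r} → x ∈ₜ l → x ∈ₜ node l k r
  inright : ∀ {l k r} → x ∈ₜ r → x ∈ₜ node l k r

data Ordered {n : ℕ} : KeyTree n → Set where
  leaf : Ordered (leaf tt)
  node : ∀ {l k r} → All (_< k) (λ _ → Unit) l → All (k <_) (λ _ → Unit) r →
         Ordered l → Ordered r → Ordered (node l k r)

IsBST : KeyTree n → Set
IsBST T = Ordered T × (∀ k → k ∈ₜ T)

-- The nodes visited by the search for x.
path : KeyTree n → Fin n → Subset n
path (leaf _) x = ⊥
path (node l k r) x with <-cmp x k
... | tri< _ _ _ = ⁅ k ⁆ ∪ path l x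
... | tri≈ _ _ _ = ⁅ k ⁆
... | tri> _ _ _ = ⁅ k ⁆ ∪ path r x

------------------------------------------------------------------------
-- Rotations

infix 4 _⟶_ _⟶*_

data _⟶_ {N L : Set} : Tree N L → Tree N L → Set where
  rotateʳ : ∀ {a u b v c} → node (node a u b) v c ⟶ node a u (node b v c)
  rotateˡ : ∀ {a u b v c} → node a u (node b v c) ⟶ node (node a u b) v c
  inleft  : ∀ {l l′ k r} → l ⟶ l′ → node l k r ⟶ node l′ k r
  inright : ∀ {l k r r′} → r ⟶ r′ → node l k r ⟶ node l k r′

_⟶*_ : Tree N L → Tree N L → Set
_⟶*_ = Star _⟶_

rotatedEdge : {s t : Tree N L} → s ⟶ t → N × N
rotatedEdge (rotateʳ {u = u} {v = v}) = u , v
rotatedEdge (rotateˡ {u = u} {v = v}) = u , v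
rotatedEdge (inleft ρ)  = rotatedEdge ρ
rotatedEdge (inright ρ) = rotatedEdge ρ

endpoints : {s t : Tree N L} → s ⟶* t → List N
endpoints ε        = []
endpoints (ρ ◅ ρs) = proj₁ (rotatedEdge ρ) ∷ proj₂ (rotatedEdge ρ) ∷ endpoints ρs

------------------------------------------------------------------------
-- Minimal subtrees

-- The nodes of the tree path between a and b.
between : KeyTree n → Fin n → Fin n → Subset n
between (leaf _) a b = ⊥
between (node l k r) a b with <-cmp a k | <-cmp b k
... | tri< _ _ _ | tri< _ _ _ = between l a b
... | tri> _ _ _ | tri> _ _ _ = between r a b
... | _          | _          = path (node l k r) a ∪ path (node l k r) b

-- The minimal subtree containing the given nodes; see spanning-minimal.
spanning : KeyTree n → List (Fin n) → Subset n
spanning T R = ⋃ (cartesianProductWith (between T) R R)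

data Child {n : ℕ} : KeyTree n → Fin n → Fin n → Set where
  leftChild  : ∀ {a v b u r} → Child (node (node a v b) u r) u v
  rightChild : ∀ {l u a v b} → Child (node l u (node a v b)) u v
  inleft     : ∀ {l k r u v} → Child l u v → Child (node l k r) u v
  inright    : ∀ {l k r u v} → Child r u v → Child (node l k r) u v

AdjacentWithin : KeyTree n → Subset n → Fin n → Fin n → Set
AdjacentWithin T S u v = SymClosure (Child T) u v × u ∈ S × v ∈ S

Walk : KeyTree n → Subset n → Fin n → Fin n → Set
Walk T S = Star (AdjacentWithin T S)

-- "Subtree" in the graph-theoretic sense: a connected set of nodes.
record IsSubtree (T : KeyTree n) (S : Subset n) : Set where
  field
    nodes     : ∀ {u} → u ∈ S → u ∈ₜ T
    connected : ∀ {u v} → u ∈ S → v ∈ S → Walk T S u v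

record IsMinimalSubtree (T : KeyTree n) (R : List (Fin n)) (S : Subset n) : Set where
  field
    subtree  : IsSubtree T S
    contains : ∀ {x} → x L.∈ R → x ∈ S
    minimal  : ∀ S′ → IsSubtree T S′ → (∀ {x} → x L.∈ R → x ∈ S′) → S ⊆ S′

private
  data Root {n : ℕ} : KeyTree n → Fin n → Set where
    root : ∀ {l k r} → Root (node l k r) k

  lookup : ∀ {P : Fin n → Set} {T : KeyTree n} {u} → All P (λ _ → Unit) T → u ∈ₜ T → P u
  lookup (node _ p _) here        = p
  lookup (node p _ _) (inleft i)  = lookup p i
  lookup (node _ _ p) (inright i) = lookup p i

  child-∈ : ∀ {T : KeyTree n} {u v} → Child T u v → u ∈ₜ T × v ∈ₜ T
  child-∈ leftChild  = here , inleft here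
  child-∈ rightChild = here , inright here
  child-∈ (inleft c)  = inleft (proj₁ (child-∈ c)) , inleft (proj₂ (child-∈ c))
  child-∈ (inright c) = inright (proj₁ (child-∈ c)) , inright (proj₂ (child-∈ c))

  walk-map : ∀ {T T′ : KeyTree n} {S S′ u v} → (∀ {x y} → Child T x y → Child T′ x y) → S ⊆ S′ →
             Walk T S u v → Walk T′ S′ u v
  walk-map f g = gmap id λ { (fwd c , p , q) → fwd (f c) , g p , g q
                           ; (bwd c , p , q) → bwd (f c) , g p , g q }

  walk-sym : ∀ {T : KeyTree n} {S u v} → Walk T S u v → Walk T S v u
  walk-sym = reverse λ { (fwd c , p , q) → bwd c , q , p ; (bwd c , p , q) → fwd c , q , p }

  -- Search paths

  path-root : ∀ {T : KeyTree n} {k} → Root T k → ∀ x → k ∈ path T x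
  path-root (root {k = k}) x with <-cmp x k
  ... | tri< _ _ _ = x∈p∪q⁺ (inj₁ (x∈⁅x⁆ k))
  ... | tri≈ _ _ _ = x∈⁅x⁆ k
  ... | tri> _ _ _ = x∈p∪q⁺ (inj₁ (x∈⁅x⁆ k))

  path-∋ : ∀ {T : KeyTree n} {x} → Ordered T → x ∈ₜ T → x ∈ path T x
  path-∋ {T = node l k r} {x} (node l< r> ol or) i with <-cmp x k | i
  ... | tri< _ x≢k _ | here      = ⊥-elim (x≢k refl)
  ... | tri< _ _ _   | inleft j  = x∈p∪q⁺ (inj₂ (path-∋ ol j))
  ... | tri< _ _ x≯k | inright j = ⊥-elim (x≯k (lookup r> j))
  ... | tri≈ _ refl _ | _        = x∈⁅x⁆ k
  ... | tri> _ x≢k _ | here      = ⊥-elim (x≢k refl)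
  ... | tri> x≮k _ _ | inleft j  = ⊥-elim (x≮k (lookup l< j))
  ... | tri> _ _ _   | inright j = x∈p∪q⁺ (inj₂ (path-∋ or j))

  path-nodes : ∀ (T : KeyTree n) x {u} → u ∈ path T x → u ∈ₜ T
  path-nodes (leaf _) x i = ⊥-elim (∉⊥ i)
  path-nodes (node l k r) x i with <-cmp x k
  ... | tri≈ _ _ _ rewrite x∈⁅y⁆⇒x≡y k i = here
  ... | tri< _ _ _ with x∈p∪q⁻ ⁅ k ⁆ _ i
  ...   | inj₁ j rewrite x∈⁅y⁆⇒x≡y k j = here
  ...   | inj₂ j = inleft (path-nodes l x j)
  path-nodes (node l k r) x i | tri> _ _ _ with x∈p∪q⁻ ⁅ k ⁆ _ i
  ...   | inj₁ j rewrite x∈⁅y⁆⇒x≡y k j = here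
  ...   | inj₂ j = inright (path-nodes r x j)

  path-walk : ∀ {T : KeyTree n} {k} → Root T k → ∀ x {u} → u ∈ path T x → Walk T (path T x) k u
  path-walk (root {l} {k} {r}) x i with <-cmp x k
  ... | tri≈ _ _ _ rewrite x∈⁅y⁆⇒x≡y k i = ε
  ... | tri< _ _ _ with x∈p∪q⁻ ⁅ k ⁆ _ i
  ...   | inj₁ j rewrite x∈⁅y⁆⇒x≡y k j = ε
  ...   | inj₂ j = descend l j
    where
    descend : ∀ l {u} → u ∈ path l x → Walk (node l k r) (⁅ k ⁆ ∪ path l x) k u
    descend (leaf _) j = ⊥-elim (∉⊥ j)
    descend (node a v b) j =
      (fwd leftChild , x∈p∪q⁺ (inj₁ (x∈⁅x⁆ k)) , x∈p∪q⁺ (inj₂ (path-root (root {l = a} {r = b}) x)))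
      ◅ walk-map inleft (x∈p∪q⁺ ∘ inj₂) (path-walk root x j)
  path-walk (root {l} {k} {r}) x i | tri> _ _ _ with x∈p∪q⁻ ⁅ k ⁆ _ i
  ...   | inj₁ j rewrite x∈⁅y⁆⇒x≡y k j = ε
  ...   | inj₂ j = descend r j
    where
    descend : ∀ r {u} → u ∈ path r x → Walk (node l k r) (⁅ k ⁆ ∪ path r x) k u
    descend (leaf _) j = ⊥-elim (∉⊥ j)
    descend (node a v b) j =
      (fwd rightChild , x∈p∪q⁺ (inj₁ (x∈⁅x⁆ k)) , x∈p∪q⁺ (inj₂ (path-root (root {l = a} {r = b}) x)))
      ◅ walk-map inright (x∈p∪q⁺ ∘ inj₂) (path-walk root x j)

  -- A case analysis of between

  data Between {n : ℕ} : (T : KeyTree n) (a b : Fin n) → Subset n → Set where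
    leaf  : ∀ {a b} → Between (leaf tt) a b ⊥
    left  : ∀ {l k r a b} → a < k → b < k → Between (node l k r) a b (between l a b)
    right : ∀ {l k r a b} → k < a → k < b → Between (node l k r) a b (between r a b)
    split : ∀ {l k r a b} → (a < k → ¬ (b < k)) → (k < a → ¬ (k < b)) →
            (b < k → ¬ (a < k)) → (k < b → ¬ (k < a)) →
            Between (node l k r) a b (path (node l k r) a ∪ path (node l k r) b)

  between-view : ∀ (T : KeyTree n) a b → Between T a b (between T a b)
  between-view (leaf _) a b = leaf
  between-view (node l k r) a b with <-cmp a k | <-cmp b k
  ... | tri< p _ _ | tri< q _ _ = left p q
  ... | tri> _ _ p | tri> _ _ q = right p q
  ... | tri< p _ a≯k | tri≈ q _ q′ = split (λ _ → q) (λ _ → q′) (λ b<k _ → q b<k) (λ k<b _ → q′ k<b)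
  ... | tri< p _ a≯k | tri> q _ q′ = split (λ _ → q) (λ a>k _ → a≯k a>k) (λ b<k _ → q b<k) (λ _ → a≯k)
  ... | tri≈ p _ p′ | tri< q _ q′ = split (λ a<k _ → p a<k) (λ _ → q′) (λ _ → p) (λ _ → p′)
  ... | tri≈ p _ p′ | tri≈ q _ q′ = split (λ _ → q) (λ _ → q′) (λ _ → p) (λ _ → p′)
  ... | tri≈ p _ p′ | tri> q _ q′ = split (λ _ → q) (λ a>k _ → p′ a>k) (λ _ → p) (λ _ → p′)
  ... | tri> p _ p′ | tri< q _ q′ = split (λ a<k _ → p a<k) (λ _ → q′) (λ _ → p) (λ k<b _ → q′ k<b)
  ... | tri> p _ p′ | tri≈ q _ q′ = split (λ a<k _ → p a<k) (λ _ → q′) (λ _ → p) (λ k<b _ → q′ k<b)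

  ∈-left : ∀ {l r : KeyTree n} {k a} → Ordered (node l k r) → a < k → a ∈ₜ node l k r → a ∈ₜ l
  ∈-left o a<k here = ⊥-elim (<-irrefl refl a<k)
  ∈-left o a<k (inleft i) = i
  ∈-left (node _ r> _ _) a<k (inright i) = ⊥-elim (<-asym a<k (lookup r> i))

  ∈-right : ∀ {l r : KeyTree n} {k a} → Ordered (node l k r) → k < a → a ∈ₜ node l k r → a ∈ₜ r
  ∈-right o k<a here = ⊥-elim (<-irrefl refl k<a)
  ∈-right (node l< _ _ _) k<a (inleft i) = ⊥-elim (<-asym k<a (lookup l< i))
  ∈-right o k<a (inright i) = i

  between-nodes : ∀ (T : KeyTree n) a b {u} → u ∈ between T a b → u ∈ₜ T
  between-nodes T a b i with between T a b | between-view T a b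
  ... | _ | leaf = ⊥-elim (∉⊥ i)
  ... | _ | left {l} _ _ = inleft (between-nodes l a b i)
  ... | _ | right {r = r} _ _ = inright (between-nodes r a b i)
  ... | _ | split _ _ _ _ with x∈p∪q⁻ (path T a) _ i
  ...   | inj₁ j = path-nodes T a j
  ...   | inj₂ j = path-nodes T b j

  between-∋ : ∀ {T : KeyTree n} {a b} → Ordered T → a ∈ₜ T → b ∈ₜ T →
              a ∈ between T a b × b ∈ between T a b
  between-∋ {T = T} {a} {b} o i j with between T a b | between-view T a b | o
  ... | _ | left p q | node _ _ ol _ = between-∋ ol (∈-left o p i) (∈-left o q j)
  ... | _ | right p q | node _ _ _ or = between-∋ or (∈-right o p i) (∈-right o q j)
  ... | _ | split _ _ _ _ | _ = x∈p∪q⁺ (inj₁ (path-∋ o i)) , x∈p∪q⁺ (inj₂ (path-∋ o j))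

  between-walk : ∀ (T : KeyTree n) a b {u v} → u ∈ between T a b → v ∈ between T a b →
                 Walk T (between T a b) u v
  between-walk T a b i j with between T a b | between-view T a b
  ... | _ | leaf = ⊥-elim (∉⊥ i)
  ... | _ | left {l} _ _ = walk-map inleft id (between-walk l a b i j)
  ... | _ | right {r = r} _ _ = walk-map inright id (between-walk r a b i j)
  ... | _ | split {l} {k} {r} _ _ _ _ = walk-sym (from-root i) ◅◅ from-root j
    where
    from-root : ∀ {u} → u ∈ path T a ∪ path T b → Walk T (path T a ∪ path T b) k u
    from-root i with x∈p∪q⁻ (path T a) _ i
    ... | inj₁ p = walk-map id (x∈p∪q⁺ ∘ inj₁) (path-walk root a p)
    ... | inj₂ p = walk-map id (x∈p∪q⁺ ∘ inj₂) (path-walk root b p)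

  -- How a walk in T meets a subtree s hanging off the node k; I holds inside s.

  data Position {n : ℕ} (s : KeyTree n) (k : Fin n) (I : Fin n → Set) (u v : Fin n) : Set where
    inner  : Child s u v → I u → I v → Position s k I u v
    bridge : u ≡ k → Root s v → I v → ¬ I u → Position s k I u v
    outer  : ¬ I u → ¬ I v → Position s k I u v

  module Hanging {n : ℕ} (T s : KeyTree n) (k : Fin n) (I : Fin n → Set)
                 (position : ∀ {u v} → Child T u v → Position s k I u v) (S : Subset n) where

    exit : ∀ {a c} → I a → ¬ I c → Walk T S a c →
           k ∈ S × (∃[ j ] Root s j × j ∈ S × Walk s S a j)
    exit ia ¬ic ε = ⊥-elim (¬ic ia)
    exit ia ¬ic ((fwd c , p , q) ◅ w) with position c
    ... | bridge _ _ _ ¬ia = ⊥-elim (¬ia ia)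
    ... | outer ¬ia _      = ⊥-elim (¬ia ia)
    ... | inner c′ _ iy with exit iy ¬ic w
    ...   | k∈S , j , ρ , j∈S , w′ = k∈S , j , ρ , j∈S , (fwd c′ , p , q) ◅ w′
    exit ia ¬ic ((bwd c , p , q) ◅ w) with position c
    ... | bridge refl ρ _ _ = q , _ , ρ , p , ε
    ... | outer _ ¬ia       = ⊥-elim (¬ia ia)
    ... | inner c′ iy _ with exit iy ¬ic w
    ...   | k∈S , j , ρ , j∈S , w′ = k∈S , j , ρ , j∈S , (bwd c′ , p , q) ◅ w′

    root-unique : ∀ {T : KeyTree n} {i j} → Root T i → Root T j → i ≡ j
    root-unique root root = refl

    project : ∀ {a b} → I b → Walk T S a b →
              (I a → Walk s S a b) × (¬ I a → ∃[ j ] Root s j × Walk s S j b)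
    project ib ε = (λ _ → ε) , λ ¬ib → ⊥-elim (¬ib ib)
    project ib ((fwd c , p , q) ◅ w) with position c | project ib w
    ... | inner c′ ia iy      | f , g = (λ _ → (fwd c′ , p , q) ◅ f iy) , λ ¬ia → ⊥-elim (¬ia ia)
    ... | bridge _ ρ iy ¬ia   | f , g = (λ ia → ⊥-elim (¬ia ia)) , λ _ → _ , ρ , f iy
    ... | outer ¬ia ¬iy       | f , g = (λ ia → ⊥-elim (¬ia ia)) , λ _ → g ¬iy
    project ib ((bwd c , p , q) ◅ w) with position c | project ib w
    ... | inner c′ iy ia      | f , g = (λ _ → (bwd c′ , p , q) ◅ f iy) , λ ¬ia → ⊥-elim (¬ia ia)
    ... | outer ¬iy ¬ia       | f , g = (λ ia → ⊥-elim (¬ia ia)) , λ _ → g ¬iy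
    ... | bridge _ ρ ia ¬iy   | f , g with g ¬iy
    ...   | j , ρ′ , w′ rewrite root-unique ρ ρ′ = (λ _ → w′) , λ ¬ia → ⊥-elim (¬ia ia)

  position-left : ∀ {l r : KeyTree n} {k u v} → Ordered (node l k r) →
                  Child (node l k r) u v → Position l k (_< k) u v
  position-left (node l< _ _ _) leftChild = bridge refl root (lookup l< here) (<-irrefl refl)
  position-left (node _ r> _ _) rightChild = outer (<-irrefl refl) (<-asym (lookup r> here))
  position-left (node l< _ _ _) (inleft c) =
    inner c (lookup l< (proj₁ (child-∈ c))) (lookup l< (proj₂ (child-∈ c)))
  position-left (node _ r> _ _) (inright c) =
    outer (<-asym (lookup r> (proj₁ (child-∈ c)))) (<-asym (lookup r> (proj₂ (child-∈ c))))

  position-right : ∀ {l r : KeyTree n} {k u v} → Ordered (node l k r) →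
                   Child (node l k r) u v → Position r k (k <_) u v
  position-right (node _ r> _ _) rightChild = bridge refl root (lookup r> here) (<-irrefl refl)
  position-right (node l< _ _ _) leftChild = outer (<-irrefl refl) (<-asym (lookup l< here))
  position-right (node _ r> _ _) (inright c) =
    inner c (lookup r> (proj₁ (child-∈ c))) (lookup r> (proj₂ (child-∈ c)))
  position-right (node l< _ _ _) (inleft c) =
    outer (<-asym (lookup l< (proj₁ (child-∈ c)))) (<-asym (lookup l< (proj₂ (child-∈ c))))

  path-minimal : ∀ {T : KeyTree n} {S k a c} → Ordered T → Root T k → a ∈ S →
                 (a < k → ¬ (c < k)) → (k < a → ¬ (k < c)) →
                 Walk T S a c → path T a ⊆ S
  path-minimal {T = node l k r} {S} {a = a} o@(node _ _ ol or) root a∈S f g w i with <-cmp a k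
  ... | tri≈ _ refl _ rewrite x∈⁅y⁆⇒x≡y k i = a∈S
  ... | tri< a<k _ _
    with Hanging.exit (node l k r) l k (_< k) (position-left o) S a<k (f a<k) w
       | x∈p∪q⁻ ⁅ k ⁆ _ i
  ...   | k∈S , _ | inj₁ j rewrite x∈⁅y⁆⇒x≡y k j = k∈S
  ...   | _ , j , ρ , _ , w′ | inj₂ i′ =
    path-minimal ol ρ a∈S (λ _ → <-irrefl refl) (λ _ → <-irrefl refl) w′ i′
  path-minimal {T = node l k r} {S} {a = a} o@(node _ _ ol or) root a∈S f g w i | tri> _ _ k<a
    with Hanging.exit (node l k r) r k (k <_) (position-right o) S k<a (g k<a) w
       | x∈p∪q⁻ ⁅ k ⁆ _ i
  ...   | k∈S , _ | inj₁ j rewrite x∈⁅y⁆⇒x≡y k j = k∈S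
  ...   | _ , j , ρ , _ , w′ | inj₂ i′ =
    path-minimal or ρ a∈S (λ _ → <-irrefl refl) (λ _ → <-irrefl refl) w′ i′

  between-minimal : ∀ {T : KeyTree n} {S a b} → Ordered T → a ∈ S → b ∈ S → Walk T S a b →
                    between T a b ⊆ S
  between-minimal {T = T} {S} {a} {b} o a∈S b∈S w i with between T a b | between-view T a b | o
  ... | _ | leaf | _ = ⊥-elim (∉⊥ i)
  ... | _ | left {l} {k} p q | node _ _ ol _ = between-minimal ol a∈S b∈S
    (proj₁ (Hanging.project T l k (_< k) (position-left o) S q w) p) i
  ... | _ | right {k = k} {r = r} p q | node _ _ _ or = between-minimal or a∈S b∈S
    (proj₁ (Hanging.project T r k (k <_) (position-right o) S q w) p) i
  ... | _ | split f g f′ g′ | _ with x∈p∪q⁻ (path T a) _ i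
  ...   | inj₁ j = path-minimal o root a∈S f g w j
  ...   | inj₂ j = path-minimal o root b∈S f′ g′ (walk-sym w) j

  ∈-⋃⁺ : ∀ {p : Subset n} {ps x} → p L.∈ ps → x ∈ p → x ∈ ⋃ ps
  ∈-⋃⁺ (here refl) i = x∈p∪q⁺ (inj₁ i)
  ∈-⋃⁺ (there j)   i = x∈p∪q⁺ (inj₂ (∈-⋃⁺ j i))

  ∈-⋃⁻ : ∀ {x} (ps : List (Subset n)) → x ∈ ⋃ ps → ∃[ p ] p L.∈ ps × x ∈ p
  ∈-⋃⁻ [] i = ⊥-elim (∉⊥ i)
  ∈-⋃⁻ (p ∷ ps) i with x∈p∪q⁻ p _ i
  ... | inj₁ j = p , here refl , j
  ... | inj₂ j with ∈-⋃⁻ ps j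
  ...   | q , q∈ , k = q , there q∈ , k

  ∈-spanning⁻ : ∀ (T : KeyTree n) R {u} → u ∈ spanning T R →
                ∃[ a ] ∃[ b ] a L.∈ R × b L.∈ R × u ∈ between T a b
  ∈-spanning⁻ T R i with ∈-⋃⁻ (cartesianProductWith (between T) R R) i
  ... | p , p∈ , u∈p with ∈-cartesianProductWith⁻ (between T) R R p∈
  ...   | a , b , a∈ , b∈ , refl = a , b , a∈ , b∈ , u∈p

  between⊆spanning : ∀ (T : KeyTree n) {R a b} → a L.∈ R → b L.∈ R → between T a b ⊆ spanning T R
  between⊆spanning T a∈ b∈ = ∈-⋃⁺ (∈-cartesianProductWith⁺ (between T) a∈ b∈)

spanning-minimal : {T : KeyTree n} → IsBST T → ∀ R → IsMinimalSubtree T R (spanning T R)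
spanning-minimal {n = n} {T = T} (o , all) R = record
  { subtree = record
    { nodes = λ i → let a , b , _ , _ , j = ∈-spanning⁻ T R i in between-nodes T a b j
    ; connected = connected
    }
  ; contains = λ i → between⊆spanning T i i (proj₁ (between-∋ o (all _) (all _)))
  ; minimal = λ S′ sub R⊆S′ i →
      let a , b , a∈ , b∈ , j = ∈-spanning⁻ T R i
      in between-minimal o (R⊆S′ a∈) (R⊆S′ b∈) (IsSubtree.connected sub (R⊆S′ a∈) (R⊆S′ b∈)) j
  }
  where
  along : ∀ {a b u v} → a L.∈ R → b L.∈ R → u ∈ between T a b → v ∈ between T a b →
          Walk T (spanning T R) u v
  along {a} {b} a∈ b∈ i j = walk-map id (between⊆spanning T a∈ b∈) (between-walk T a b i j)

  connected : ∀ {u v} → u ∈ spanning T R → v ∈ spanning T R → Walk T (spanning T R) u v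
  connected i j with ∈-spanning⁻ T R i | ∈-spanning⁻ T R j
  ... | a , b , a∈ , b∈ , i′ | c , d , c∈ , d∈ , j′ =
    along a∈ b∈ i′ (proj₁ (ends a b)) ◅◅
    (along a∈ c∈ (proj₁ (ends a c)) (proj₂ (ends a c)) ◅◅ along c∈ d∈ (proj₁ (ends c d)) j′)
    where
    ends : ∀ a b → a ∈ between T a b × b ∈ between T a b
    ends a b = between-∋ o (all a) (all b)

------------------------------------------------------------------------
-- Serving a query sequence

-- Everything an algorithm does while serving X from T₀: for each query, the
-- rotations performed after the search.
data Run {n : ℕ} : ∀ {m} → KeyTree n → Vec (Fin n) m → Set where
  []  : ∀ {T} → Run T []
  _∷_ : ∀ {m T T′ x} {X : Vec (Fin n) m} → T ⟶* T′ → Run T′ X → Run T (x ∷ X)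

-- Taking the minimal subtree in the tree before the rotations is no restriction:
-- a rotation of an edge with both ends in S preserves connectedness of S, so the
-- minimal subtree is the same node set in all the intermediate trees.
stepCost : {T T′ : KeyTree n} → Fin n → T ⟶* T′ → ℕ
stepCost {T = T} x ρs = ∣ path T x ∪ spanning T (endpoints ρs) ∣

cost : {T : KeyTree n} {X : Vec (Fin n) m} → Run T X → ℕ
cost []                   = 0
cost (_∷_ {x = x} ρs run) = stepCost x ρs + cost run

IsOptimal : {T : KeyTree n} {X : Vec (Fin n) m} → Run T X → Set
IsOptimal {T = T} {X = X} opt = (run : Run T X) → cost opt ≤ cost run

idle : (T : KeyTree n) (X : Vec (Fin n) m) → Run T X
idle T []      = []
idle T (x ∷ X) = ε ∷ idle T X

-- A run of minimum cost exists (classically), so quantifying over all optimal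
-- runs is never vacuous.
optimal-exists : (T : KeyTree n) (X : Vec (Fin n) m) → ¬ ¬ (∃[ opt ] IsOptimal {T = T} {X = X} opt)
optimal-exists T X none = <-rec (λ c → (run : Run T X) → ¬ (cost run ≡ c)) search _ (idle T X) refl
  where
  search : ∀ c → (∀ {d} → d ℕ.< c → (run : Run T X) → ¬ (cost run ≡ d)) →
           (run : Run T X) → ¬ (cost run ≡ c)
  search c smaller run refl =
    none (run , λ run′ → ℕ.≮⇒≥ λ lt → smaller lt run′ refl)

------------------------------------------------------------------------
-- Treaps

module Treap (O : DecTotalOrder 0ℓ 0ℓ 0ℓ) {N L : Set} (prio : N → DecTotalOrder.Carrier O) where

  open DecTotalOrder O using () renaming (_≤_ to _⊑_; _≤?_ to _⊑?_; trans to ⊑-trans; total to ⊑-total)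

  data Above (k : N) : Tree N L → Set where
    leaf : ∀ {x} → Above k (leaf x)
    node : ∀ {l j r} → prio k ⊑ prio j → Above k (node l j r)

  data Heap : Tree N L → Set where
    leaf : ∀ {x} → Heap (leaf x)
    node : ∀ {l k r} → Above k l → Above k r → Heap l → Heap r → Heap (node l k r)

  private
    above-trans : ∀ {j k t} → prio j ⊑ prio k → Above k t → Above j t
    above-trans p leaf     = leaf
    above-trans p (node q) = node (⊑-trans p q)

    ⋢⇒⊒ : ∀ {x y} → ¬ (x ⊑ y) → y ⊑ x
    ⋢⇒⊒ {x} {y} ¬p with ⊑-total x y
    ... | inj₁ p = ⊥-elim (¬p p)
    ... | inj₂ q = q

    record Sift (l : Tree N L) (k : N) (r : Tree N L) : Set where
      constructor sifted
      field
        {result}  : Tree N L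
        rotations : node l k r ⟶* result
        heap      : Heap result
        above     : ∀ {j} → prio j ⊑ prio k → Above j l → Above j r → Above j result

    here-sift : ∀ {l k r} → Above k l → Above k r → Heap l → Heap r → Sift l k r
    here-sift al ar hl hr = sifted ε (node al ar hl hr) (λ p _ _ → node p)

    from-left : ∀ {a p b k r} → prio p ⊑ prio k → Above p r →
                Heap (node a p b) → Sift b k r → Sift (node a p b) k r
    from-left p⊑k pr (node pa pb ha _) (sifted ρs h ab) =
      sifted (rotateʳ ◅ gmap (node _ _) inright ρs)
             (node pa (ab p⊑k pb pr) ha h)
             (λ { _ (node j⊑p) _ → node j⊑p })

    from-right : ∀ {l k a q b} → prio q ⊑ prio k → Above q l →
                 Heap (node a q b) → Sift l k a → Sift l k (node a q b)
    from-right q⊑k ql (node qa qb _ hb) (sifted ρs h ab) =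
      sifted (rotateˡ ◅ gmap (λ t → node t _ _) inleft ρs)
             (node (ab q⊑k ql qa) qb h hb)
             (λ { _ _ (node j⊑q) → node j⊑q })

    choose : ∀ {a p b k c q d} →
             Dec (prio k ⊑ prio p) → Dec (prio k ⊑ prio q) → prio p ⊑ prio q ⊎ prio q ⊑ prio p →
             Heap (node a p b) → Heap (node c q d) →
             Sift b k (node c q d) → Sift (node a p b) k c → Sift (node a p b) k (node c q d)
    choose (yes k⊑p) (yes k⊑q) _ hl hr _ _ = here-sift (node k⊑p) (node k⊑q) hl hr
    choose (no k⋢p) _ (inj₁ p⊑q) hl _ s _ = from-left (⋢⇒⊒ k⋢p) (node p⊑q) hl s
    choose (yes _) (no k⋢q) (inj₁ p⊑q) hl _ s _ =
      from-left (⊑-trans p⊑q (⋢⇒⊒ k⋢q)) (node p⊑q) hl s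
    choose _ (no k⋢q) (inj₂ q⊑p) _ hr _ s = from-right (⋢⇒⊒ k⋢q) (node q⊑p) hr s
    choose (no k⋢p) (yes _) (inj₂ q⊑p) _ hr _ s =
      from-right (⊑-trans q⊑p (⋢⇒⊒ k⋢p)) (node q⊑p) hr s

    sift : ∀ l k r → Heap l → Heap r → Sift l k r
    sift (leaf x) k (leaf y) hl hr = here-sift leaf leaf hl hr
    sift (leaf x) k (node a q b) hl hr@(node _ _ ha _) with prio k ⊑? prio q
    ... | yes k⊑q = here-sift leaf (node k⊑q) hl hr
    ... | no  k⋢q = from-right (⋢⇒⊒ k⋢q) leaf hr (sift (leaf x) k a hl ha)
    sift (node a p b) k (leaf y) hl@(node _ _ _ hb) hr with prio k ⊑? prio p
    ... | yes k⊑p = here-sift (node k⊑p) leaf hl hr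
    ... | no  k⋢p = from-left (⋢⇒⊒ k⋢p) leaf hl (sift b k (leaf y) hb hr)
    sift (node a p b) k (node c q d) hl@(node _ _ _ hb) hr@(node _ _ hc _) =
      choose (prio k ⊑? prio p) (prio k ⊑? prio q) (⊑-total (prio p) (prio q))
             hl hr (sift b k (node c q d) hb hr) (sift (node a p b) k c hl hc)

  -- Rotations keep the symmetric order of nodes and leaves, so for distinct
  -- priorities the result is the unique treap on the nodes of s, with the leaves
  -- at their unique positions.
  treapify : ∀ s → Σ (Tree N L) λ t → (s ⟶* t) × Heap t
  treapify (leaf x) = leaf x , ε , leaf
  treapify (node l k r) with treapify l | treapify r
  ... | l′ , ρl , hl | r′ , ρr , hr with sift l′ k r′ hl hr
  ...   | sifted ρs h _ =
    _ , gmap (λ t → node t k r) inleft ρl ◅◅ (gmap (node l′ k) inright ρr ◅◅ ρs) , h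

------------------------------------------------------------------------
-- Greedy Future

-- The search path of x as a tree of its own; its leaves carry the hanging
-- subtrees R₀, …, R_k.
cut : KeyTree n → Fin n → Tree (Fin n) (KeyTree n)
cut (leaf _) x = leaf (leaf tt)
cut (node l k r) x with <-cmp x k
... | tri< _ _ _ = node (cut l x) k (leaf r)
... | tri≈ _ _ _ = node (leaf l) k (leaf r)
... | tri> _ _ _ = node (leaf l) k (cut r x)

graft : Tree (Fin n) (KeyTree n) → KeyTree n
graft = foldr node id

graft-cut : (T : KeyTree n) (x : Fin n) → graft (cut T x) ≡ T
graft-cut (leaf _) x = refl
graft-cut (node l k r) x with <-cmp x k
... | tri< _ _ _ = cong (λ t → node t k r) (graft-cut l x)
... | tri≈ _ _ _ = refl
... | tri> _ _ _ = cong (node l k) (graft-cut r x)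

graft-⟶ : {s t : Tree (Fin n) (KeyTree n)} → s ⟶ t → graft s ⟶ graft t
graft-⟶ rotateʳ     = rotateʳ
graft-⟶ rotateˡ     = rotateˡ
graft-⟶ (inleft ρ)  = inleft (graft-⟶ ρ)
graft-⟶ (inright ρ) = inright (graft-⟶ ρ)

-- vs is the increasing list v₁, …, v_k of path keys; ⊥± and ⊤± are v₀ and v_{k+1}.
previous next : List (Fin n) → Fin n → Fin n ±
previous vs v = maybe [_] ⊥± (last (filter (_<? v) vs))
next     vs v = maybe [_] ⊤± (head (filter (v <?_) vs))

-- τ v, counted from the current time. If no future query lies in the interval
-- this is the number of future queries, which is larger than all finite values.
τ : List (Fin n) → List (Fin n) → Fin n → ℕ
τ vs future v = length (takeWhile (λ y → ¬? (inside? y)) future)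
  where
  _<±?_ = <±-dec _<_ _<?_
  inside? = λ y → (previous vs v <±? [ y ]) ×-dec ([ y ] <±? next vs v)

-- Compared lexicographically; ∣ path T v ∣ is the depth of v, counted from 1.
priority : KeyTree n → Fin n → List (Fin n) → Fin n → ℕ × ℕ
priority T x future v = τ (Infix.toList (cut T x)) future v , ∣ path T v ∣

lexOrder : DecTotalOrder 0ℓ 0ℓ 0ℓ
lexOrder = ×-decTotalOrder ℕ.≤-decTotalOrder ℕ.≤-decTotalOrder

gfPath : (T : KeyTree n) (x : Fin n) (future : List (Fin n)) →
         Σ (Tree (Fin n) (KeyTree n)) λ t →
           (cut T x ⟶* t) × Treap.Heap lexOrder (priority T x future) t
gfPath T x future = Treap.treapify lexOrder (priority T x future) (cut T x)

gfTree : KeyTree n → Fin n → List (Fin n) → KeyTree n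
gfTree T x future = graft (proj₁ (gfPath T x future))

gfRotations : (T : KeyTree n) (x : Fin n) (future : List (Fin n)) → T ⟶* gfTree T x future
gfRotations T x future =
  subst (_⟶* gfTree T x future) (graft-cut T x) (gmap graft graft-⟶ (proj₁ (proj₂ (gfPath T x future))))

greedyFuture : (T : KeyTree n) (X : Vec (Fin n) m) → Run T X
greedyFuture T []      = []
greedyFuture T (x ∷ X) = gfRotations T x (Vec.toList X) ∷ greedyFuture _ X

------------------------------------------------------------------------
-- The additive gap

-- m · lg lg n ≤ c · (cost(GF,X,T) − cost(OPT,X,T)). The truncated subtraction is
-- exact since opt is optimal. Rounding up changes lg lg n by at most a constant
-- factor for every n ≥ 2 (both sides vanish at n = 2), which c absorbs.
GapAtLeast : ℕ → (T : KeyTree n) → Vec (Fin n) m → Set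
GapAtLeast {n = n} {m = m} c T X =
  (opt : Run T X) → IsOptimal opt →
  m * ⌈log₂ ⌈log₂ n ⌉ ⌉ ≤ c * (cost (greedyFuture T X) ∸ cost opt)

-- n ^ (lg lg n / (a · lg lg lg n)) ≤ m ≤ n ^ (b · lg lg n / lg lg lg n), with the
-- denominators cleared and the logarithms rounded up; for n ≥ 5 rounding again
-- costs at most a constant factor.
LengthBetween : (a b n m : ℕ) → Set
LengthBetween a b n m =
  n ^ ⌈log₂ ⌈log₂ n ⌉ ⌉ ≤ m ^ (a * ⌈log₂ ⌈log₂ ⌈log₂ n ⌉ ⌉ ⌉) ×
  m ^ ⌈log₂ ⌈log₂ ⌈log₂ n ⌉ ⌉ ⌉ ≤ n ^ (b * ⌈log₂ ⌈log₂ n ⌉ ⌉)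

module Submission where

open import Defs
open import Data.Bool using (true; false)
open import Data.Empty using (⊥-elim)
open import Data.Fin as Fin using (Fin; zero; toℕ; _<_)
open import Data.Fin.Properties using (_<?_; <-cmp; <-asym; <-irrefl; <-trans; ≤-refl; toℕ-fromℕ<)
open import Data.Fin.Subset using (Subset; _∪_; ∣_∣; ⁅_⁆) renaming (_∈_ to _∈ˢ_; _∉_ to _∉ˢ_)
open import Data.Fin.Subset.Properties
  using (∉⊥; x∈⁅x⁆; x∈⁅y⁆⇒x≡y; x∈p∪q⁺; x∈p∪q⁻; p⊂q⇒∣p∣<∣q∣; ∣p∣≤∣p∪q∣; ∣p∣≤n; ∣⁅x⁆∣≡1; ∣⊥∣≡0; ∪-identityʳ; q⊆p∪q)
open import Data.List using (List; []; _∷_; _++_; filter; head; last; length; takeWhile; map; replicate)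
open import Data.List.Membership.Propositional using (_∈_; _∉_)
open import Data.List.Membership.Propositional.Properties using (∈-++⁺ʳ; ∈-filter⁺; ∈-filter⁻)
open import Data.List.Properties
  using (++-assoc; ++-identityʳ; ∷-injective; filter-++; filter-all; filter-none; filter-accept; filter-reject;
         length-replicate; length-++; map-cong-local)
open import Data.List.Relation.Unary.All as All using (All; []; _∷_)
import Data.List.Relation.Unary.All.Properties as All
open import Data.List.Relation.Unary.AllPairs using (AllPairs; []; _∷_)
import Data.List.Relation.Unary.AllPairs.Properties as AllPairs
open import Data.List.Relation.Unary.Any using (Any; here; there)
open import Data.List.Relation.Unary.Any.Properties using (++⁺ˡ; ++⁺ʳ; ++⁻)
open import Data.List.Relation.Unary.Linked as Linked using (Linked; []; [-]; _∷_)
open import Data.Maybe using (just; nothing)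
open import Data.Nat as ℕ
  using (ℕ; zero; suc; _≤_; _+_; _*_; _∸_; _^_; _⊔_; z≤n; s≤s; NonZero; ⌈_/2⌉; ⌊_/2⌋; >-nonZero)
open import Data.Nat.DivMod using (_/_; _%_; _mod_; m<n⇒m%n≡m; m≡m%n+[m/n]*n; m%n<n; m/n*n≤m)
open import Data.Nat.Induction using (<-rec)
open import Data.Nat.ListAction using (sum)
open import Data.Nat.Logarithm using (⌈log₂_⌉; ⌈log₂⌉-mono-≤; ⌈log₂⌈n/2⌉⌉≡⌈log₂n⌉∸1; ⌈log₂2^n⌉≡n)
import Data.Nat.Properties as ℕ
open import Data.Nat.Tactic.RingSolver using (solve-∀)
open import Data.Product using (Σ; _×_; _,_; proj₁; proj₂; ∃-syntax)
open import Data.Sum using (_⊎_; inj₁; inj₂; [_,_]′)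
open import Data.Tree.Binary using (Tree; leaf; node; module Infix)
open import Data.Tree.Binary.Relation.Unary.All as TreeAll using (leaf; node)
open import Data.Unit using (tt) renaming (⊤ to Unit)
open import Data.Vec using (Vec; []; _∷_; fromList; toList)
open import Data.Vec.Properties using (toList∘fromList)
open import Function using (_∘_)
open import Level using (0ℓ)
open import Relation.Binary using (DecTotalOrder; tri<; tri≈; tri>)
open import Relation.Binary.Construct.Add.Extrema.Strict using (<±-dec; _<±_; [<]-injective; ⊥±<[_]; [_]; [_]<⊤±)
open import Relation.Binary.Construct.Closure.ReflexiveTransitive using (ε; _◅_; _◅◅_; gmap)
open import Relation.Binary.PropositionalEquality
  using (_≡_; refl; sym; trans; cong; cong₂; subst; subst₂)
open import Relation.Nullary using (¬_; yes; no; ¬?)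
open import Relation.Nullary.Construct.Add.Extrema using ([_])
open import Relation.Nullary.Decidable using (_×-dec_)
open import Relation.Unary using (Pred; Decidable)

-- Suppose that below every node of T consecutive queries go to opposite sides.
-- After each query, the next one below a node u of its search path then lies in
-- the interval of u but in none of the intervals of the path nodes below u, so T
-- is the treap that Greedy Future builds, and it pays the depth in T. Querying a key
-- twice in a row makes it the root, and interleaving all later queries with it
-- keeps it there; recursively this forces Greedy Future into any given tree T,
-- starting from any T₀, at a cost independent of the length of what follows.
--
-- In T only the bottom keys are queried, a key at depth d with frequency 2^-d,
-- while OPT may move to a static tree B with queried keys as inner nodes. Let
-- T(K) consist of a copy of T(K-1), and to its right a left comb of e+1 further
-- copies with an additional key c at its bottom left end, and let B(K) be the same
-- tree with c moved to the root. No query becomes more expensive in B(K), and one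
-- with frequency 2^-(e+2) gains about e. After K = 2^(e+2) levels a constant
-- fraction of the queries gains about e = Θ(lg lg n).

private variable
  N L : Set
  n : ℕ

-- Rotations and symmetric order

-- Leaves are listed as well: in a cut tree they carry the hanging subtrees, whose positions have to
-- survive rotations too.
inorder : Tree N L → List (N ⊎ L)
inorder (leaf x)     = inj₂ x ∷ []
inorder (node l k r) = inorder l ++ inj₁ k ∷ inorder r

inorder-⟶ : {s t : Tree N L} → s ⟶ t → inorder s ≡ inorder t
inorder-⟶ (rotateʳ {a} {u} {b} {v} {c}) = ++-assoc (inorder a) (inj₁ u ∷ inorder b) (inj₁ v ∷ inorder c)
inorder-⟶ (rotateˡ {a} {u} {b} {v} {c}) =
  sym (++-assoc (inorder a) (inj₁ u ∷ inorder b) (inj₁ v ∷ inorder c))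
inorder-⟶ (inleft {k = k} {r} ρ)  = cong (_++ inj₁ k ∷ inorder r) (inorder-⟶ ρ)
inorder-⟶ (inright {l} {k} ρ) = cong (λ z → inorder l ++ inj₁ k ∷ z) (inorder-⟶ ρ)

inorder-⟶* : {s t : Tree N L} → s ⟶* t → inorder s ≡ inorder t
inorder-⟶* ε        = refl
inorder-⟶* (ρ ◅ ρs) = trans (inorder-⟶ ρ) (inorder-⟶* ρs)

∈ₜ⇒∈-inorder : {t : Tree N L} {v : N} → v ∈ₜ t → inj₁ v ∈ inorder t
∈ₜ⇒∈-inorder {t = node l _ _} here        = ++⁺ʳ (inorder l) (here refl)
∈ₜ⇒∈-inorder                  (inleft i)  = ++⁺ˡ (∈ₜ⇒∈-inorder i)
∈ₜ⇒∈-inorder {t = node l _ _} (inright i) = ++⁺ʳ (inorder l) (there (∈ₜ⇒∈-inorder i))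

∈-inorder⇒∈ₜ : (t : Tree N L) {v : N} → inj₁ v ∈ inorder t → v ∈ₜ t
∈-inorder⇒∈ₜ (leaf _) (here ())
∈-inorder⇒∈ₜ (node l k r) i with ++⁻ (inorder l) i
... | inj₁ j           = inleft (∈-inorder⇒∈ₜ l j)
... | inj₂ (here refl) = here
... | inj₂ (there j)   = inright (∈-inorder⇒∈ₜ r j)

∈ₜ-resp : {s : Tree N L} (t : Tree N L) {v : N} → inorder s ≡ inorder t → v ∈ₜ s → v ∈ₜ t
∈ₜ-resp t {v} eq i = ∈-inorder⇒∈ₜ t (subst (inj₁ v ∈_) eq (∈ₜ⇒∈-inorder i))

inorder-leaf : (t : Tree N L) {x : L} → inorder t ≡ inj₂ x ∷ [] → t ≡ leaf x
inorder-leaf (leaf _) refl = refl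
inorder-leaf (node l k r) eq with ∈-inorder⇒∈ₜ (leaf _) (subst (inj₁ k ∈_) eq (∈ₜ⇒∈-inorder {t = node l k r} here))
... | ()

-- `a` occurs only once in the common list, so both splittings cut at the same place. Knowing the
-- root of a rearranged tree thus fixes what lies on either side of it.
++-∷-unique : ∀ {A : Set} {a : A} xs {ys} xs′ {ys′} → a ∉ xs → a ∉ ys →
              xs ++ a ∷ ys ≡ xs′ ++ a ∷ ys′ → xs ≡ xs′ × ys ≡ ys′
++-∷-unique []       []         _    _    refl = refl , refl
++-∷-unique []       (x ∷ xs′)  _    a∉ys eq =
  ⊥-elim (a∉ys (subst (_ ∈_) (sym (proj₂ (∷-injective eq))) (∈-++⁺ʳ xs′ (here refl))))
++-∷-unique (x ∷ xs) []         a∉xs _    eq = ⊥-elim (a∉xs (here (sym (proj₁ (∷-injective eq)))))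
++-∷-unique (x ∷ xs) (x′ ∷ xs′) a∉xs a∉ys eq with ∷-injective eq
... | refl , eq′ with ++-∷-unique xs xs′ (a∉xs ∘ there) a∉ys eq′
...   | refl , ys≡ = refl , ys≡

inorder-children : (l r l′ r′ : Tree N L) {k : N} → ¬ (k ∈ₜ l) → ¬ (k ∈ₜ r) →
                   inorder (node l′ k r′) ≡ inorder (node l k r) →
                   inorder l′ ≡ inorder l × inorder r′ ≡ inorder r
inorder-children l r l′ r′ k∉l k∉r eq
  with ++-∷-unique (inorder l) (inorder l′) (k∉l ∘ ∈-inorder⇒∈ₜ l) (k∉r ∘ ∈-inorder⇒∈ₜ r) (sym eq)
... | p , q = sym p , sym q

lookup : {P : N → Set} {Q : L → Set} {t : Tree N L} {u : N} → TreeAll.All P Q t → u ∈ₜ t → P u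
lookup (node _ p _) here        = p
lookup (node p _ _) (inleft i)  = lookup p i
lookup (node _ _ p) (inright i) = lookup p i

∈-left : {l r : KeyTree n} {k v : Fin n} → Ordered (node l k r) → v < k → v ∈ₜ node l k r → v ∈ₜ l
∈-left o v<k here = ⊥-elim (<-irrefl refl v<k)
∈-left o v<k (inleft i) = i
∈-left (node _ r> _ _) v<k (inright i) = ⊥-elim (<-asym v<k (lookup r> i))

∈-right : {l r : KeyTree n} {k v : Fin n} → Ordered (node l k r) → k < v → v ∈ₜ node l k r → v ∈ₜ r
∈-right o k<v here = ⊥-elim (<-irrefl refl k<v)
∈-right (node l< _ _ _) k<v (inleft i) = ⊥-elim (<-asym k<v (lookup l< i))
∈-right o k<v (inright i) = i

All-⟶ : {P : N → Set} {Q : L → Set} {s t : Tree N L} → s ⟶ t → TreeAll.All P Q s → TreeAll.All P Q t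
All-⟶ rotateʳ (node (node a u b) v c) = node a u (node b v c)
All-⟶ rotateˡ (node a u (node b v c)) = node (node a u b) v c
All-⟶ (inleft ρ) (node l k r)  = node (All-⟶ ρ l) k r
All-⟶ (inright ρ) (node l k r) = node l k (All-⟶ ρ r)

Ordered-⟶ : {s t : KeyTree n} → s ⟶ t → Ordered s → Ordered t
Ordered-⟶ rotateʳ (node (node a<v u<v b<v) c> (node a< b> oa ob) oc) =
  node a< (node b> u<v (TreeAll.map (<-trans u<v) _ c>)) oa (node b<v c> ob oc)
Ordered-⟶ rotateˡ (node a< (node b> u<v c>u) oa (node b<v c> ob oc)) =
  node (node (TreeAll.map (λ p → <-trans p u<v) _ a<) u<v b<v) c> (node a< b> oa ob) oc
Ordered-⟶ (inleft ρ) (node l< r> ol or)  = node (All-⟶ ρ l<) r> (Ordered-⟶ ρ ol) or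
Ordered-⟶ (inright ρ) (node l< r> ol or) = node l< (All-⟶ ρ r>) ol (Ordered-⟶ ρ or)

Ordered-⟶* : {s t : KeyTree n} → s ⟶* t → Ordered s → Ordered t
Ordered-⟶* ε        o = o
Ordered-⟶* (ρ ◅ ρs) o = Ordered-⟶* ρs (Ordered-⟶ ρ o)

IsBST-⟶* : {s t : KeyTree n} → s ⟶* t → IsBST s → IsBST t
IsBST-⟶* ρs (o , all) = Ordered-⟶* ρs o , λ k → ∈ₜ-resp _ (inorder-⟶* ρs) (all k)

-- Cutting out a search path and putting it back

cut-⊆ : (T : KeyTree n) (x : Fin n) {v : Fin n} → v ∈ₜ cut T x → v ∈ₜ T
cut-⊆ (node l k r) x i with <-cmp x k | i
... | tri< _ _ _ | here = here
... | tri< _ _ _ | inleft j = inleft (cut-⊆ l x j)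
... | tri≈ _ _ _ | here = here
... | tri> _ _ _ | here = here
... | tri> _ _ _ | inright j = inright (cut-⊆ r x j)

∈-cut : {T : KeyTree n} {x : Fin n} → Ordered T → x ∈ₜ T → x ∈ₜ cut T x
∈-cut {T = node l k r} {x} o@(node _ _ ol or) i with <-cmp x k
... | tri< x<k _ _  = inleft (∈-cut ol (∈-left o x<k i))
... | tri≈ _ refl _ = here
... | tri> _ _ k<x  = inright (∈-cut or (∈-right o k<x i))

-- The way in which an entry of `inorder t` puts `v` into the grafted tree: as a path key or inside
-- a hanging subtree. Membership in `graft t` thereby depends on `inorder t` alone.
data Carries (v : Fin n) : Fin n ⊎ KeyTree n → Set where
  token   : Carries v (inj₁ v)
  subtree : ∀ {t} → v ∈ₜ t → Carries v (inj₂ t)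

∈-graft⁻ : (t : Tree (Fin n) (KeyTree n)) {v : Fin n} → v ∈ₜ graft t → Any (Carries v) (inorder t)
∈-graft⁻ (leaf x) i = here (subtree i)
∈-graft⁻ (node l k r) here        = ++⁺ʳ (inorder l) (here token)
∈-graft⁻ (node l k r) (inleft i)  = ++⁺ˡ (∈-graft⁻ l i)
∈-graft⁻ (node l k r) (inright i) = ++⁺ʳ (inorder l) (there (∈-graft⁻ r i))

∈-graft⁺ : (t : Tree (Fin n) (KeyTree n)) {v : Fin n} → Any (Carries v) (inorder t) → v ∈ₜ graft t
∈-graft⁺ (leaf x) (here (subtree i)) = i
∈-graft⁺ (node l k r) i with ++⁻ (inorder l) i
... | inj₁ j          = inleft (∈-graft⁺ l j)
... | inj₂ (here token) = here
... | inj₂ (there j)  = inright (∈-graft⁺ r j)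

∈-graft-cut : (T : KeyTree n) (x : Fin n) (t : Tree (Fin n) (KeyTree n)) {v : Fin n} →
              inorder t ≡ inorder (cut T x) → v ∈ₜ T → v ∈ₜ graft t
∈-graft-cut T x t {v} eq i =
  ∈-graft⁺ t (subst (Any (Carries v)) (sym eq) (∈-graft⁻ (cut T x) (subst (v ∈ₜ_) (sym (graft-cut T x)) i)))

-- Roots of heaps

module _ (O : DecTotalOrder 0ℓ 0ℓ 0ℓ) {N L : Set} (prio : N → DecTotalOrder.Carrier O) where
  open DecTotalOrder O using () renaming (_≤_ to _⊑_; trans to ⊑-trans; refl to ⊑-refl)
  open Treap O {N} {L} prio

  above-all : ∀ {k v t} → Above k t → Heap t → v ∈ₜ t → prio k ⊑ prio v
  above-all (node p) _               here        = p
  above-all (node p) (node a _ hl _) (inleft i)  = ⊑-trans p (above-all a hl i)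
  above-all (node p) (node _ a _ hr) (inright i) = ⊑-trans p (above-all a hr i)

  root-minimal : ∀ {l k r v} → Heap (node l k r) → v ∈ₜ node l k r → prio k ⊑ prio v
  root-minimal h i = above-all (node ⊑-refl) h i

  -- The root's priority is at most that of `k`, which strictness allows for `k` alone. The shape of
  -- Greedy Future's treap is read off in this way, one level at a time.
  heap-root : ∀ {k t} → Heap t → k ∈ₜ t → (∀ {v} → v ∈ₜ t → v ≡ k ⊎ ¬ (prio v ⊑ prio k)) →
              ∃[ l ] ∃[ r ] t ≡ node l k r
  heap-root {t = node l j r} h k∈t strict with strict {j} here
  ... | inj₁ refl = l , r , refl
  ... | inj₂ j⋢k  = ⊥-elim (j⋢k (root-minimal h k∈t))

-- Trees forced upon Greedy Future

-- The tree `T` of the idea. Its tips are the keys queried in the long run; fork keys are queried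
-- only during the setup.
data Alpha (n : ℕ) : Set where
  tip  : Fin n → Alpha n
  fork : Alpha n → Fin n → Alpha n → Alpha n

data Within {n : ℕ} (lo hi : ℕ) : Alpha n → Set where
  tip  : ∀ {q} → lo ≤ toℕ q → toℕ q ℕ.< hi → Within lo hi (tip q)
  fork : ∀ {l k r} → lo ≤ toℕ k → toℕ k ℕ.< hi →
         Within lo (toℕ k) l → Within (suc (toℕ k)) hi r → Within lo hi (fork l k r)

-- Fork keys only, since `setup` places nothing else: a tip merely stands for whatever subtree
-- remains there.
data _∈ᶠ_ {n : ℕ} (v : Fin n) : Alpha n → Set where
  here    : ∀ {l r} → v ∈ᶠ fork l v r
  inleft  : ∀ {l k r} → v ∈ᶠ l → v ∈ᶠ fork l k r
  inright : ∀ {l k r} → v ∈ᶠ r → v ∈ᶠ fork l k r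

InRange : ℕ → ℕ → Fin n → Set
InRange lo hi x = lo ≤ toℕ x × toℕ x ℕ.< hi

∈ᶠ-range : ∀ {T : Alpha n} {lo hi v} → Within lo hi T → v ∈ᶠ T → InRange lo hi v
∈ᶠ-range (fork lo≤k k<hi _ _) here = lo≤k , k<hi
∈ᶠ-range (fork lo≤k k<hi wl wr) (inleft i) =
  let lo≤v , v<k = ∈ᶠ-range wl i in lo≤v , ℕ.<-trans v<k k<hi
∈ᶠ-range (fork lo≤k k<hi wl wr) (inright i) =
  let k<v , v<hi = ∈ᶠ-range wr i in ℕ.≤-trans lo≤k (ℕ.<⇒≤ k<v) , v<hi

weave : {A : Set} → A → List A → List A
weave k []       = []
weave k (x ∷ xs) = x ∷ k ∷ weave k xs

All-weave : {A : Set} {P : Pred A 0ℓ} {k : A} {xs : List A} → P k → All P xs → All P (weave k xs)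
All-weave pk []       = []
All-weave pk (p ∷ ps) = p ∷ pk ∷ All-weave pk ps

setup : Alpha n → List (Fin n)
setup (tip _)      = []
setup (fork l k r) = k ∷ k ∷ weave k (setup l ++ setup r)

setup-range : ∀ {T : Alpha n} {lo hi} → Within lo hi T → All (InRange lo hi) (setup T)
setup-range (tip _ _) = []
setup-range (fork lo≤k k<hi wl wr) = (lo≤k , k<hi) ∷ (lo≤k , k<hi) ∷ All-weave (lo≤k , k<hi)
  (All.++⁺ (All.map (λ (p , q) → p , ℕ.<-trans q k<hi) (setup-range wl))
           (All.map (λ (p , q) → ℕ.≤-trans lo≤k (ℕ.<⇒≤ p) , q) (setup-range wr)))

-- A query of `k` itself is opposite to every query, so interleaving with `k` always alternates.
Opposite : Fin n → Fin n → Fin n → Set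
Opposite k x y = ¬ (x < k × y < k) × ¬ (k < x × k < y)

Alternates : Fin n → List (Fin n) → Set
Alternates k = Linked (Opposite k)

Steady : Alpha n → List (Fin n) → Set
Steady (tip _)      F = Unit
Steady (fork l k r) F = Alternates k F × Steady l (filter (_<? k) F) × Steady r (filter (k <?_) F)

alternates-∷ : ∀ {k : Fin n} {F} → Alternates k F → Alternates k (k ∷ F)
alternates-∷ {F = []}    _ = [-]
alternates-∷ {F = _ ∷ _} a = (<-irrefl refl ∘ proj₁ , <-irrefl refl ∘ proj₁) ∷ a

alternates-weave : ∀ {k : Fin n} xs {F} → Alternates k F → Alternates k (k ∷ weave k xs ++ F)
alternates-weave []       a = alternates-∷ a
alternates-weave (x ∷ xs) a =
  alternates-∷ ((<-irrefl refl ∘ proj₂ , <-irrefl refl ∘ proj₂) ∷ alternates-weave xs a)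

filter-weave : ∀ {A : Set} {P : Pred A 0ℓ} (P? : Decidable P) {k : A} → ¬ P k → ∀ xs F →
               filter P? (weave k xs ++ F) ≡ filter P? xs ++ filter P? F
filter-weave P? ¬pk []       F = refl
filter-weave P? ¬pk (x ∷ xs) F with P? x
... | yes p = cong (x ∷_) (trans (filter-reject P? ¬pk) (filter-weave P? ¬pk xs F))
... | no ¬p = trans (filter-reject P? ¬pk) (filter-weave P? ¬pk xs F)

filter-setup : ∀ {A : Set} {P : Pred A 0ℓ} (P? : Decidable P) {k : A} → ¬ P k → ∀ xs ys F →
               filter P? (k ∷ weave k (xs ++ ys) ++ F) ≡ (filter P? xs ++ filter P? ys) ++ filter P? F
filter-setup P? ¬pk xs ys F = trans (filter-reject P? ¬pk)
  (trans (filter-weave P? ¬pk (xs ++ ys) F) (cong (_++ filter P? F) (filter-++ P? xs ys)))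

-- T describes the intended top part of the current tree A, and F lists the
-- remaining queries among the keys of A.
data Inv {n : ℕ} : Alpha n → KeyTree n → List (Fin n) → Set where
  tip     : ∀ {q A F} → Inv (tip q) A F
  -- `Respects` orders nothing once no query is left, so no shape is claimed then.
  done    : ∀ {T A} → Inv T A []
  fresh   : ∀ {T A Q F} → Steady T Q → (∀ {v} → v ∈ᶠ T → v ∈ₜ A) → F ≡ setup T ++ Q → Inv T A F
  settled : ∀ {l k r Al Ar F} → Alternates k F →
            Inv l Al (filter (_<? k) F) → Inv r Ar (filter (k <?_) F) →
            Inv (fork l k r) (node Al k Ar) F

-- Some entry satisfies `P`, and neither it nor any earlier entry satisfies `Q`. With intervals for
-- `P` and `Q` this is a strict inequality between values of `τ`, witnessed by the queries
-- themselves.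
data First {A : Set} (P Q : A → Set) : List A → Set where
  now   : ∀ {x xs} → P x → ¬ Q x → First P Q (x ∷ xs)
  later : ∀ {x xs} → ¬ Q x → First P Q xs → First P Q (x ∷ xs)

-- The entries that filtering removes fail `P?`, hence fail `R`, and so cannot come too early.
first-filter : ∀ {A : Set} {P Q Q′ R R′ : Pred A 0ℓ} (P? : Decidable P) →
               (∀ {y} → P y → Q′ y → Q y) → (∀ {y} → R y → P y × R′ y) →
               ∀ xs → First Q′ R′ (filter P? xs) → First Q R xs
first-filter P? f g (x ∷ xs) i with P? x
... | no ¬p = later (¬p ∘ proj₁ ∘ g) (first-filter P? f g xs i)
... | yes p with i
...   | now q ¬r   = now (f p q) (¬r ∘ proj₂ ∘ g)
...   | later ¬r j = later (¬r ∘ proj₂ ∘ g) (first-filter P? f g xs j)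

-- The query y lies strictly between the neighbours of v on the path s.
Hit : {L : Set} → Tree (Fin n) L → Fin n → Fin n → Set
Hit s v y = ∀ u → u ∈ₜ s → (u < v → u < y) × (v < u → y < u)

module _ {n : ℕ} (prio : Fin n → ℕ × ℕ) where
  open DecTotalOrder lexOrder using () renaming (_≤_ to _⊑_)
  open Treap lexOrder {Fin n} {KeyTree n} prio

  -- All that the invariant has to know about the priorities. In contrast to `τ` it can be
  -- restricted to a subtree together with the queries that fall into it.
  Respects : Tree (Fin n) (KeyTree n) → List (Fin n) → Set
  Respects s G = ∀ {v w} → v ∈ₜ s → w ∈ₜ s → First (Hit s v) (Hit s w) G → ¬ (prio w ⊑ prio v)

  -- Down a settled part of the path, each fork key in turn is the strict minimum of what remains of
  -- the path, so it keeps its place. Subtrees off the path are carried over, and their lists of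
  -- remaining queries do not change.
  step : ∀ (T : Alpha n) {lo hi A x G t} → Within lo hi T → Ordered A → x ∈ₜ A → Ordered (graft t) →
         inorder t ≡ inorder (cut A x) → Heap t → Respects (cut A x) G →
         Inv T A (x ∷ G) → Inv T (graft t) G

  -- After `x < k` the next query `y` is not left of `k`. It hits the interval of `k`, while all
  -- other path nodes are smaller than `k` and have intervals that end at `k` or before. Hence `k`
  -- stays on top and the rest takes place inside `Al`.
  step-left : ∀ (l : Alpha n) {k r lo hi Al Ar x G t} → Within lo hi l → Ordered (node Al k Ar) →
              x < k → x ∈ₜ Al → Ordered (graft t) →
              inorder t ≡ inorder (node (cut Al x) k (leaf Ar)) → Heap t →
              Respects (node (cut Al x) k (leaf Ar)) G →
              Alternates k (x ∷ G) → Inv l Al (x ∷ filter (_<? k) G) → Inv r Ar (filter (k <?_) G) →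
              Inv (fork l k r) (graft t) G
  step-left l {G = []} _ _ _ _ _ _ _ _ _ _ _ = done
  step-left l {k} {Al = Al} {Ar} {x} {y ∷ G} {t} w (node l< r> ol or) x<k x∈ ogt eq h R ((¬both , _) ∷ alt) il ir
    = conclude {t} (heap-root lexOrder prio h (∈ₜ-resp {s = s} t (sym eq) here) strict) ogt eq h
    where
    s = node (cut Al x) k (leaf Ar)
    below : ∀ {u} → u ∈ₜ cut Al x → u < k
    below i = lookup l< (cut-⊆ Al x i)
    hit-k : Hit s k y
    hit-k _ here       = (λ p → ⊥-elim (<-irrefl refl p)) , λ p → ⊥-elim (<-irrefl refl p)
    hit-k _ (inleft i) = (λ u<k → ℕ.<-≤-trans u<k (ℕ.≮⇒≥ λ y<k → ¬both (x<k , y<k))) ,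
                       λ k<u → ⊥-elim (<-asym k<u (below i))
    strict : ∀ {v} → v ∈ₜ t → v ≡ k ⊎ ¬ (prio v ⊑ prio k)
    strict i with ∈ₜ-resp s eq i
    ... | here     = inj₁ refl
    ... | inright ()
    ... | inleft j = inj₂ (R here (inleft j) (now hit-k λ hit → ¬both (x<k , proj₂ (hit _ here) (below j))))
    -- The path inside `Al` lacks `k`, but `k` bounds no query below `k`, and no other query hits a
    -- path node left of `k`.
    Rl : Respects (cut Al x) (filter (_<? k) (y ∷ G))
    Rl i j f = R (inleft i) (inleft j) (first-filter (_<? k)
      (λ y<k hit → λ { _ here → (λ k<v → ⊥-elim (<-asym k<v (below i))) , (λ _ → y<k) ; _ (inleft u∈) → hit _ u∈ })
      (λ hit → proj₂ (hit _ here) (below j) , λ _ u∈ → hit _ (inleft u∈)) (y ∷ G) f)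
    conclude : ∀ {t} → ∃[ tl ] ∃[ tr ] t ≡ node tl k tr → Ordered (graft t) → inorder t ≡ inorder s → Heap t →
               Inv (fork l k _) (graft t) (y ∷ G)
    conclude (tl , tr , refl) (node _ _ ogl _) eq (node _ _ hl _)
      with inorder-children (cut Al x) (leaf Ar) tl tr (<-irrefl refl ∘ below) (λ ()) eq
    ... | eql , eqr with inorder-leaf tr eqr
    ...   | refl = settled alt (step l {t = tl} w ol x∈ ogl eql hl Rl il) ir

  -- The mirror image of `step-left`.
  step-right : ∀ (r : Alpha n) {l k lo hi Al Ar x G t} → Within lo hi r → Ordered (node Al k Ar) →
               k < x → x ∈ₜ Ar → Ordered (graft t) →
               inorder t ≡ inorder (node (leaf Al) k (cut Ar x)) → Heap t →
               Respects (node (leaf Al) k (cut Ar x)) G →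
               Alternates k (x ∷ G) → Inv l Al (filter (_<? k) G) → Inv r Ar (x ∷ filter (k <?_) G) →
               Inv (fork l k r) (graft t) G
  step-right r {G = []} _ _ _ _ _ _ _ _ _ _ _ = done
  step-right r {k = k} {Al = Al} {Ar} {x} {y ∷ G} {t} w (node l< r> ol or) k<x x∈ ogt eq h R ((_ , ¬both) ∷ alt) il ir
    = conclude {t} (heap-root lexOrder prio h (∈ₜ-resp {s = s} t (sym eq) here) strict) ogt eq h
    where
    s = node (leaf Al) k (cut Ar x)
    above : ∀ {u} → u ∈ₜ cut Ar x → k < u
    above i = lookup r> (cut-⊆ Ar x i)
    hit-k : Hit s k y
    hit-k _ here        = (λ p → ⊥-elim (<-irrefl refl p)) , λ p → ⊥-elim (<-irrefl refl p)
    hit-k _ (inright i) = (λ u<k → ⊥-elim (<-asym u<k (above i))) ,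
                        λ k<u → ℕ.≤-<-trans (ℕ.≮⇒≥ λ k<y → ¬both (k<x , k<y)) k<u
    strict : ∀ {v} → v ∈ₜ t → v ≡ k ⊎ ¬ (prio v ⊑ prio k)
    strict i with ∈ₜ-resp s eq i
    ... | here      = inj₁ refl
    ... | inleft ()
    ... | inright j = inj₂ (R here (inright j) (now hit-k λ hit → ¬both (k<x , proj₁ (hit _ here) (above j))))
    Rr : Respects (cut Ar x) (filter (k <?_) (y ∷ G))
    Rr i j f = R (inright i) (inright j) (first-filter (k <?_)
      (λ k<y hit → λ { _ here → (λ _ → k<y) , (λ v<k → ⊥-elim (<-asym v<k (above i))) ; _ (inright u∈) → hit _ u∈ })
      (λ hit → proj₁ (hit _ here) (above j) , λ _ u∈ → hit _ (inright u∈)) (y ∷ G) f)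
    conclude : ∀ {t} → ∃[ tl ] ∃[ tr ] t ≡ node tl k tr → Ordered (graft t) → inorder t ≡ inorder s → Heap t →
               Inv (fork _ k r) (graft t) (y ∷ G)
    conclude (tl , tr , refl) (node _ _ _ ogr) eq (node _ _ _ hr)
      with inorder-children (leaf Al) (cut Ar x) tl tr (λ ()) (<-irrefl refl ∘ above) eq
    ... | eql , eqr with inorder-leaf tl eql
    ...   | refl = settled alt il (step r {t = tr} w or x∈ ogr eqr hr Rr ir)

  -- Since k is queried twice in a row, the first of these queries brings it to the root.
  step-fresh : ∀ {l r : Alpha n} {lo hi A k G t Q} → Within lo hi (fork l k r) → Ordered A →
               (∀ {v} → v ∈ᶠ fork l k r → v ∈ₜ A) → Ordered (graft t) →
               inorder t ≡ inorder (cut A k) → Heap t → Respects (cut A k) G →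
               Steady (fork l k r) Q → G ≡ k ∷ weave k (setup l ++ setup r) ++ Q →
               Inv (fork l k r) (graft t) G
  step-fresh {l} {r} {A = A} {k} {t = t} {Q} (fork _ _ wl wr) o T⊆A ogt eq h R (alt , sl , sr) refl
    = conclude {t} (heap-root lexOrder prio h (∈ₜ-resp t (sym eq) k∈) strict) ogt eq
    where
    k∈ = ∈-cut o (T⊆A here)
    -- As `k` is on the path, the repeated query of `k` falls into no interval but that of `k`.
    strict : ∀ {v} → v ∈ₜ t → v ≡ k ⊎ ¬ (prio v ⊑ prio k)
    strict {v} i with <-cmp v k
    ... | tri≈ _ v≡k _ = inj₁ v≡k
    ... | tri< v<k _ _ = inj₂ (R k∈ (∈ₜ-resp (cut A k) eq i)
            (now (λ _ _ → (λ p → p) , λ p → p) λ hit → <-irrefl refl (proj₂ (hit k k∈) v<k)))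
    ... | tri> _ _ k<v = inj₂ (R k∈ (∈ₜ-resp (cut A k) eq i)
            (now (λ _ _ → (λ p → p) , λ p → p) λ hit → <-irrefl refl (proj₁ (hit k k∈) k<v)))
    -- Each side is left with its own setup followed by its share of `Q`; the copies of `k` and the
    -- setup of the other side are filtered out.
    filter-l : filter (_<? k) (k ∷ weave k (setup l ++ setup r) ++ Q) ≡ setup l ++ filter (_<? k) Q
    filter-l = trans (filter-setup (_<? k) (<-irrefl refl) (setup l) (setup r) Q)
      (cong (_++ filter (_<? k) Q) (trans
        (cong₂ _++_ (filter-all (_<? k) (All.map proj₂ (setup-range wl)))
                    (filter-none (_<? k) (All.map (λ p → <-asym (proj₁ p)) (setup-range wr))))
        (++-identityʳ _)))
    filter-r : filter (k <?_) (k ∷ weave k (setup l ++ setup r) ++ Q) ≡ setup r ++ filter (k <?_) Q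
    filter-r = trans (filter-setup (k <?_) (<-irrefl refl) (setup l) (setup r) Q)
      (cong (_++ filter (k <?_) Q)
        (cong₂ _++_ (filter-none (k <?_) (All.map (λ p → <-asym (proj₂ p)) (setup-range wl)))
                    (filter-all (k <?_) (All.map proj₁ (setup-range wr)))))
    conclude : ∀ {t} → ∃[ tl ] ∃[ tr ] t ≡ node tl k tr → Ordered (graft t) → inorder t ≡ inorder (cut A k) →
               Inv (fork l k r) (graft t) _
    conclude (tl , tr , refl) ogt eq = settled (alternates-weave (setup l ++ setup r) alt)
      (fresh sl (λ i → ∈-left {l = graft tl} {graft tr} ogt (proj₂ (∈ᶠ-range wl i)) (∈-graft-cut A k (node tl k tr) eq (T⊆A (inleft i)))) filter-l)
      (fresh sr (λ i → ∈-right {l = graft tl} {graft tr} ogt (proj₁ (∈ᶠ-range wr i)) (∈-graft-cut A k (node tl k tr) eq (T⊆A (inright i)))) filter-r)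

  step (tip _) _ _ _ _ _ _ _ _ = tip
  step (fork l k r) {t = t} w o _ ogt eq h R (fresh st T⊆A refl) = step-fresh {t = t} w o T⊆A ogt eq h R st refl
  step (fork l k r) {x = x} {G} {t} (fork _ _ wl wr) o x∈ ogt eq h R (settled {Al = Al} {Ar} alt il ir)
    with <-cmp x k
  ... | tri< x<k _ k≮x = step-left l {t = t} wl o x<k (∈-left o x<k x∈) ogt eq h R alt
        (subst (Inv l Al) (filter-accept (_<? k) x<k) il) (subst (Inv r Ar) (filter-reject (k <?_) k≮x) ir)
  ... | tri> x≮k _ k<x = step-right r {t = t} wr o k<x (∈-right o k<x x∈) ogt eq h R alt
        (subst (Inv l Al) (filter-reject (_<? k) x≮k) il) (subst (Inv r Ar) (filter-accept (k <?_) k<x) ir)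
  -- The search ends at the root, so the path is `k` alone and nothing moves.
  ... | tri≈ _ refl _ = conclude {t} (heap-root lexOrder prio h (∈ₜ-resp {s = node (leaf Al) k (leaf Ar)} t (sym eq) here) (only ∘ ∈ₜ-resp _ eq)) eq
    where
    only : ∀ {v} → v ∈ₜ node (leaf Al) k (leaf Ar) → v ≡ k ⊎ ¬ (prio v ⊑ prio k)
    only here = inj₁ refl
    conclude : ∀ {t} → ∃[ tl ] ∃[ tr ] t ≡ node tl k tr → inorder t ≡ inorder (node (leaf Al) k (leaf Ar)) →
               Inv (fork l k r) (graft t) G
    conclude (tl , tr , refl) eq with inorder-children (leaf Al) (leaf Ar) tl tr (λ ()) (λ ()) eq
    ... | eql , eqr with inorder-leaf tl eql | inorder-leaf tr eqr
    ...   | refl | refl = settled (Linked.tail alt)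
            (subst (Inv l Al) (filter-reject (_<? k) (<-irrefl refl)) il)
            (subst (Inv r Ar) (filter-reject (k <?_) (<-irrefl refl)) ir)

-- The costs of Greedy Future and of a static tree

toDiffList-++ : ∀ {N L : Set} (t : Tree N L) xs → Infix.toDiffList t xs ≡ Infix.toList t ++ xs
toDiffList-++ (leaf _) xs = refl
toDiffList-++ (node l k r) xs
  rewrite toDiffList-++ l (k ∷ Infix.toDiffList r xs)
        | toDiffList-++ l (k ∷ Infix.toDiffList r [])
        | toDiffList-++ r xs
  = sym (++-assoc (Infix.toList l) (k ∷ Infix.toList r) xs)

toList-node : ∀ {N L : Set} (l : Tree N L) k r → Infix.toList (node l k r) ≡ Infix.toList l ++ k ∷ Infix.toList r
toList-node l k r = toDiffList-++ l (k ∷ Infix.toList r)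

∈-toList⁺ : ∀ {N L : Set} {t : Tree N L} {v} → v ∈ₜ t → v ∈ Infix.toList t
∈-toList⁺ {t = node l k r} i rewrite toList-node l k r with i
... | here      = ++⁺ʳ (Infix.toList l) (here refl)
... | inleft j  = ++⁺ˡ (∈-toList⁺ j)
... | inright j = ++⁺ʳ (Infix.toList l) (there (∈-toList⁺ j))

∈-toList⁻ : ∀ {N L : Set} (t : Tree N L) {v} → v ∈ Infix.toList t → v ∈ₜ t
∈-toList⁻ (leaf _) ()
∈-toList⁻ (node l k r) i rewrite toList-node l k r with ++⁻ (Infix.toList l) i
... | inj₁ j           = inleft (∈-toList⁻ l j)
... | inj₂ (here refl) = here
... | inj₂ (there j)   = inright (∈-toList⁻ r j)

toList-sorted : (l r : Tree (Fin n) L) {k : Fin n} →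
                (∀ {v} → v ∈ₜ l → v < k) → (∀ {v} → v ∈ₜ r → k < v) →
                AllPairs _<_ (Infix.toList l) → AllPairs _<_ (Infix.toList r) →
                AllPairs _<_ (Infix.toList (node l k r))
toList-sorted l r {k} l< r> sl sr rewrite toList-node l k r =
  AllPairs.++⁺ sl (All.tabulate (r> ∘ ∈-toList⁻ r) ∷ sr)
    (All.tabulate λ i → l< (∈-toList⁻ l i) ∷ All.tabulate λ j → <-trans (l< (∈-toList⁻ l i)) (r> (∈-toList⁻ r j)))

cut-sorted : {T : KeyTree n} → Ordered T → ∀ x → AllPairs _<_ (Infix.toList (cut T x))
cut-sorted leaf x = []
cut-sorted {T = node l k r} (node l< r> ol or) x with <-cmp x k
... | tri< _ _ _ = toList-sorted (cut l x) (leaf r) (λ i → lookup l< (cut-⊆ l x i)) (λ ()) (cut-sorted ol x) []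
... | tri≈ _ _ _ = [] ∷ []
... | tri> _ _ _ = toList-sorted (leaf l) (cut r x) (λ ()) (λ i → lookup r> (cut-⊆ r x i)) [] (cut-sorted or x)

last-∈ : ∀ {A : Set} (xs : List A) {z} → last xs ≡ just z → z ∈ xs
last-∈ (x ∷ [])     refl = here refl
last-∈ (x ∷ y ∷ xs) eq   = there (last-∈ (y ∷ xs) eq)

last-max : ∀ {xs : List (Fin n)} {u} → AllPairs _<_ xs → u ∈ xs → ∃[ z ] last xs ≡ just z × u Fin.≤ z
last-max {xs = x ∷ []}     _       (here refl) = x , refl , ≤-refl
last-max {xs = x ∷ y ∷ xs} (p ∷ s) i with last-max s (here refl) | i
... | z , eq , y≤z | here refl = z , eq , ℕ.≤-trans (ℕ.<⇒≤ (All.head p)) y≤z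
... | _            | there j   = last-max s j

head-∈ : ∀ {A : Set} (xs : List A) {z} → head xs ≡ just z → z ∈ xs
head-∈ (x ∷ xs) refl = here refl

head-min : ∀ {xs : List (Fin n)} {u} → AllPairs _<_ xs → u ∈ xs → ∃[ z ] head xs ≡ just z × z Fin.≤ u
head-min {xs = x ∷ xs} _       (here refl) = x , refl , ≤-refl
head-min {xs = x ∷ xs} (p ∷ _) (there j)   = x , refl , ℕ.<⇒≤ (All.lookup p j)

Inside : List (Fin n) → Fin n → Fin n → Set
Inside vs v y = (_<±_ _<_ (previous vs v) [ y ]) × (_<±_ _<_ [ y ] (next vs v))

-- Agrees by computation with the test inside `τ`, so the `takeWhile` over its negation has length
-- `τ`.
inside? : (vs : List (Fin n)) (v : Fin n) → Decidable (Inside vs v)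
inside? vs v y = <±-dec _<_ _<?_ (previous vs v) [ y ] ×-dec <±-dec _<_ _<?_ [ y ] (next vs v)

hit⇒inside : {t : Tree (Fin n) L} {v y : Fin n} → Hit t v y → Inside (Infix.toList t) v y
hit⇒inside {n = n} {t = t} {v} {y} hit = left , right
  where
  vs = Infix.toList t
  left : _<±_ _<_ (previous vs v) [ y ]
  left with last (filter (_<? v) vs) in eq
  ... | nothing = ⊥±<[ y ]
  ... | just z with ∈-filter⁻ (_<? v) {xs = vs} (last-∈ _ eq)
  ...   | z∈ , z<v = [ proj₁ (hit z (∈-toList⁻ t z∈)) z<v ]
  right : _<±_ _<_ [ y ] (next vs v)
  right with head (filter (v <?_) vs) in eq
  ... | nothing = [ y ]<⊤±
  ... | just z with ∈-filter⁻ (v <?_) {xs = vs} (head-∈ _ eq)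
  ...   | z∈ , v<z = [ proj₂ (hit z (∈-toList⁻ t z∈)) v<z ]

-- In a sorted list the neighbours of `v` are the largest key below and the smallest key above it,
-- so a query between these two is on the right side of all others.
inside⇒hit : {t : Tree (Fin n) L} {v y : Fin n} → AllPairs _<_ (Infix.toList t) →
             Inside (Infix.toList t) v y → Hit t v y
inside⇒hit {t = t} {v} {y} sorted (p , q) u u∈ = left , right
  where
  left : u < v → u < y
  left u<v with last-max (AllPairs.filter⁺ (_<? v) sorted) (∈-filter⁺ (_<? v) (∈-toList⁺ u∈) u<v)
  ... | z , eq , u≤z rewrite eq = ℕ.≤-<-trans u≤z ([<]-injective _<_ p)
  right : v < u → y < u
  right v<u with head-min (AllPairs.filter⁺ (v <?_) sorted) (∈-filter⁺ (v <?_) (∈-toList⁺ u∈) v<u)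
  ... | z , eq , z≤u rewrite eq = ℕ.<-≤-trans ([<]-injective _<_ q) z≤u

first-map : ∀ {A : Set} {P Q P′ Q′ : Pred A 0ℓ} → (∀ {x} → P x → P′ x) → (∀ {x} → Q′ x → Q x) →
            ∀ {xs} → First P Q xs → First P′ Q′ xs
first-map f g (now p ¬q)   = now (f p) (¬q ∘ g)
first-map f g (later ¬q i) = later (¬q ∘ g) (first-map f g i)

first⇒takeWhile-< : ∀ {A : Set} {P Q : Pred A 0ℓ} (P? : Decidable P) (Q? : Decidable Q) {xs : List A} → First P Q xs →
                    length (takeWhile (¬? ∘ P?) xs) ℕ.< length (takeWhile (¬? ∘ Q?) xs)
first⇒takeWhile-< P? Q? (now {x} p ¬q) with P? x | Q? x
... | yes _ | no _  = s≤s z≤n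
... | yes _ | yes q = ⊥-elim (¬q q)
... | no ¬p | _     = ⊥-elim (¬p p)
first⇒takeWhile-< P? Q? (later {x} ¬q i) with P? x | Q? x
... | yes _ | no _  = s≤s z≤n
... | no  _ | no _  = s≤s (first⇒takeWhile-< P? Q? i)
... | _     | yes q = ⊥-elim (¬q q)

-- An earlier hit makes `τ` strictly smaller, and this decides the lexicographic comparison before
-- depths are consulted.
priority-respects : {A : KeyTree n} → Ordered A → ∀ x F → Respects (priority A x F) (cut A x) F
priority-respects {A = A} o x F {v} {w} _ _ f w⊑v =
  ℕ.<⇒≱ (first⇒takeWhile-< (inside? vs v) (inside? vs w) (first-map (hit⇒inside {t = cut A x}) (inside⇒hit {t = cut A x} (cut-sorted o x)) f))
         ([ proj₁ , ℕ.≤-reflexive ∘ proj₁ ]′ w⊑v)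
  where vs = Infix.toList (cut A x)

gf-step : ∀ {T : Alpha n} {lo hi A} → Within lo hi T → IsBST A → ∀ x F →
          Inv T A (x ∷ F) → Inv T (gfTree A x F) F
gf-step {T = T} {A = A} w (o , all) x F inv = step (priority A x F) T {t = proj₁ (gfPath A x F)}
  w o (all x) (Ordered-⟶* (gfRotations A x F) o)
  (sym (inorder-⟶* (proj₁ (proj₂ (gfPath A x F))))) (proj₂ (proj₂ (gfPath A x F))) (priority-respects o x F) inv

-- Depths and costs

depth : KeyTree n → Fin n → ℕ
depth (leaf _) x = 0
depth (node l k r) x with <-cmp x k
... | tri< _ _ _ = suc (depth l x)
... | tri≈ _ _ _ = 1
... | tri> _ _ _ = suc (depth r x)

toTree : Alpha n → KeyTree n
toTree (tip q)      = node (leaf _) q (leaf _)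
toTree (fork l k r) = node (toTree l) k (toTree r)

∣p∪q∣≤∣p∣+∣q∣ : (p q : Subset n) → ∣ p ∪ q ∣ ≤ ∣ p ∣ + ∣ q ∣
∣p∪q∣≤∣p∣+∣q∣ [] [] = z≤n
∣p∪q∣≤∣p∣+∣q∣ (false ∷ p) (false ∷ q) = ∣p∪q∣≤∣p∣+∣q∣ p q
∣p∪q∣≤∣p∣+∣q∣ (false ∷ p) (true ∷ q) rewrite ℕ.+-suc ∣ p ∣ ∣ q ∣ = s≤s (∣p∪q∣≤∣p∣+∣q∣ p q)
∣p∪q∣≤∣p∣+∣q∣ (true ∷ p) (false ∷ q) = s≤s (∣p∪q∣≤∣p∣+∣q∣ p q)
∣p∪q∣≤∣p∣+∣q∣ (true ∷ p) (true ∷ q) =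
  s≤s (ℕ.≤-trans (∣p∪q∣≤∣p∣+∣q∣ p q) (ℕ.+-monoʳ-≤ ∣ p ∣ (ℕ.n≤1+n ∣ q ∣)))

path-⊆ : (T : KeyTree n) (x : Fin n) {u : Fin n} → u ∈ˢ path T x → u ∈ₜ T
path-⊆ (leaf _) x i = ⊥-elim (∉⊥ i)
path-⊆ (node l k r) x i with <-cmp x k
... | tri≈ _ _ _ rewrite x∈⁅y⁆⇒x≡y k i = here
... | tri< _ _ _ with x∈p∪q⁻ ⁅ k ⁆ _ i
...   | inj₁ j rewrite x∈⁅y⁆⇒x≡y k j = here
...   | inj₂ j = inleft (path-⊆ l x j)
path-⊆ (node l k r) x i | tri> _ _ _ with x∈p∪q⁻ ⁅ k ⁆ _ i
...   | inj₁ j rewrite x∈⁅y⁆⇒x≡y k j = here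
...   | inj₂ j = inright (path-⊆ r x j)

∣path∣≤depth : (T : KeyTree n) (x : Fin n) → ∣ path T x ∣ ≤ depth T x
∣path∣≤depth {n = n} (leaf _) x = ℕ.≤-reflexive (∣⊥∣≡0 n)
∣path∣≤depth (node l k r) x with <-cmp x k
... | tri< _ _ _ = ℕ.≤-trans (∣p∪q∣≤∣p∣+∣q∣ ⁅ k ⁆ (path l x))
                     (ℕ.+-mono-≤ (ℕ.≤-reflexive (∣⁅x⁆∣≡1 k)) (∣path∣≤depth l x))
... | tri≈ _ _ _ = ℕ.≤-reflexive (∣⁅x⁆∣≡1 k)
... | tri> _ _ _ = ℕ.≤-trans (∣p∪q∣≤∣p∣+∣q∣ ⁅ k ⁆ (path r x))
                     (ℕ.+-mono-≤ (ℕ.≤-reflexive (∣⁅x⁆∣≡1 k)) (∣path∣≤depth r x))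

∣p∣<∣⁅k⁆∪p∣ : (k : Fin n) (p : Subset n) → k ∉ˢ p → ∣ p ∣ ℕ.< ∣ ⁅ k ⁆ ∪ p ∣
∣p∣<∣⁅k⁆∪p∣ k p k∉p = p⊂q⇒∣p∣<∣q∣ (q⊆p∪q ⁅ k ⁆ p , k , x∈p∪q⁺ (inj₁ (x∈⁅x⁆ k)) , k∉p)

depth≤∣path∣ : {T : KeyTree n} → Ordered T → ∀ x → depth T x ≤ ∣ path T x ∣
depth≤∣path∣ leaf x = z≤n
depth≤∣path∣ {T = node l k r} (node l< r> ol or) x with <-cmp x k
... | tri< _ _ _ = ℕ.≤-<-trans (depth≤∣path∣ ol x)
                     (∣p∣<∣⁅k⁆∪p∣ k (path l x) λ i → <-irrefl refl (lookup l< (path-⊆ l x i)))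
... | tri≈ _ _ _ = ℕ.≤-reflexive (sym (∣⁅x⁆∣≡1 k))
... | tri> _ _ _ = ℕ.≤-<-trans (depth≤∣path∣ or x)
                     (∣p∣<∣⁅k⁆∪p∣ k (path r x) λ i → <-irrefl refl (lookup r> (path-⊆ r x i)))

1≤depth : {T : KeyTree n} {v : Fin n} → v ∈ₜ T → ∀ x → 1 ≤ depth T x
1≤depth {T = node l k r} _ x with <-cmp x k
... | tri< _ _ _ = s≤s z≤n
... | tri≈ _ _ _ = s≤s z≤n
... | tri> _ _ _ = s≤s z≤n

tip-depth : (q x : Fin n) → depth (toTree (tip q)) x ≡ 1
tip-depth q x with <-cmp x q
... | tri< _ _ _ = refl
... | tri≈ _ _ _ = refl
... | tri> _ _ _ = refl

-- The settled forks of `T` that the search meets are nodes of `A` on the search path. A fresh fork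
-- cannot be met: its first remaining query would be its own key, and `x` is no fork key.
inv-depth : ∀ {T : Alpha n} {A x F} → Ordered A → x ∈ₜ A → Inv T A (x ∷ F) → ¬ (x ∈ᶠ T) →
            depth (toTree T) x ≤ depth A x
inv-depth {T = tip q} {x = x} _ x∈ _ _ rewrite tip-depth q x = 1≤depth x∈ x
inv-depth {T = fork l k r} _ _ (fresh _ _ refl) x∉ = ⊥-elim (x∉ here)
inv-depth {T = fork l k r} {x = x} o@(node _ _ ol or) x∈ (settled {Al = Al} {Ar} _ il ir) x∉ with <-cmp x k
... | tri< x<k _ _ = s≤s (inv-depth ol (∈-left o x<k x∈) (subst (Inv l Al) (filter-accept (_<? k) x<k) il) (x∉ ∘ inleft))
... | tri≈ _ _ _   = ℕ.≤-refl
... | tri> _ _ k<x = s≤s (inv-depth or (∈-right o k<x x∈) (subst (Inv r Ar) (filter-accept (k <?_) k<x) ir) (x∉ ∘ inright))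

gf-step-fromList : ∀ {T : Alpha n} {lo hi A} → Within lo hi T → IsBST A → ∀ x F →
           Inv T A (x ∷ F) → Inv T (gfTree A x (toList (fromList F))) F
gf-step-fromList {T = T} {A = A} w bst x F inv = subst (Inv T _) (toList∘fromList F)
  (gf-step w bst x _ (subst (λ F → Inv T A (x ∷ F)) (sym (toList∘fromList F)) inv))

-- The queries of `S` only drive the invariant forward and are charged nothing. Each query of `Q` is
-- charged its search path, which is at least as long as in `T`.
gf-cost : ∀ {T : Alpha n} {lo hi A} → Within lo hi T → IsBST A → ∀ S Q → Inv T A (S ++ Q) →
          All (λ x → ¬ (x ∈ᶠ T)) Q → sum (map (depth (toTree T)) Q) ≤ cost (greedyFuture A (fromList (S ++ Q)))
gf-cost w bst [] [] inv [] = z≤n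
gf-cost {T = T} {A = A} w bst@(o , all) [] (x ∷ Q) inv (x∉ ∷ Q∉) = ℕ.+-mono-≤
  (ℕ.≤-trans (inv-depth o (all x) inv x∉) (ℕ.≤-trans (depth≤∣path∣ o x) (∣p∣≤∣p∪q∣ (path A x) _)))
  (gf-cost w (IsBST-⟶* (gfRotations A x (toList (fromList Q))) bst) [] Q (gf-step-fromList w bst x Q inv) Q∉)
gf-cost {A = A} w bst (x ∷ S) Q inv Q∉ = ℕ.≤-trans
  (gf-cost w (IsBST-⟶* (gfRotations A x (toList (fromList (S ++ Q)))) bst) S Q (gf-step-fromList w bst x (S ++ Q) inv) Q∉)
  (ℕ.m≤n+m _ _)

idle-cost : (B : KeyTree n) (S : List (Fin n)) (Q : List (Fin n)) →
            cost (idle B (fromList (S ++ Q))) ≤ length S * n + sum (map (depth B) Q)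
idle-cost B [] []      = z≤n
idle-cost B [] (x ∷ Q) = ℕ.+-mono-≤
  (subst (_≤ depth B x) (sym (cong ∣_∣ (∪-identityʳ (path B x)))) (∣path∣≤depth B x)) (idle-cost B [] Q)
idle-cost {n = n} B (x ∷ S) Q rewrite ℕ.+-assoc n (length S * n) (sum (map (depth B) Q)) =
  ℕ.+-mono-≤ (∣p∣≤n (path B x ∪ _)) (idle-cost B S Q)

-- The competitor rotates to `B` after the first query and then never moves. A single query costs at
-- most `n` whatever is rotated; the extra `n` pays for the move when `S` is empty.
optimal-cost : {T B : KeyTree n} → T ⟶* B → ∀ S Q (opt : Run T (fromList (S ++ Q))) → IsOptimal opt →
               cost opt ≤ suc (length S) * n + sum (map (depth B) Q)
optimal-cost ρs [] [] [] best = z≤n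
optimal-cost {n = n} {T} {B} ρs [] (x ∷ Q) opt best = begin
  cost opt                            ≤⟨ best (ρs ∷ idle B (fromList Q)) ⟩
  ∣ path T x ∪ moved ∣ + cost (idle B (fromList Q))
    ≤⟨ ℕ.+-mono-≤ (∣p∣≤n (path T x ∪ moved)) (idle-cost B [] Q) ⟩
  n + sum (map (depth B) Q)           ≤⟨ ℕ.+-mono-≤ (ℕ.≤-reflexive (sym (ℕ.*-identityˡ n))) (ℕ.m≤n+m _ (depth B x)) ⟩
  1 * n + sum (map (depth B) (x ∷ Q)) ∎
  where
  open ℕ.≤-Reasoning
  moved = spanning T (endpoints ρs)
optimal-cost {n = n} {T} {B} ρs (s ∷ S) Q opt best = begin
  cost opt                                         ≤⟨ best (ρs ∷ idle B (fromList (S ++ Q))) ⟩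
  ∣ path T s ∪ moved ∣ + cost (idle B (fromList (S ++ Q)))
    ≤⟨ ℕ.+-mono-≤ (∣p∣≤n (path T s ∪ moved)) (idle-cost B S Q) ⟩
  n + (length S * n + sum (map (depth B) Q))       ≡⟨ ℕ.+-assoc n (length S * n) _ ⟨
  suc (length S) * n + sum (map (depth B) Q)       ≤⟨ ℕ.+-monoˡ-≤ _ (ℕ.m≤n+m (suc (length S) * n) n) ⟩
  suc (length (s ∷ S)) * n + sum (map (depth B) Q) ∎
  where
  open ℕ.≤-Reasoning
  moved = spanning T (endpoints ρs)

to-root : ∀ {N L : Set} {k : N} {T : Tree N L} → k ∈ₜ T → ∃[ l ] ∃[ r ] T ⟶* node l k r
to-root here = _ , _ , ε
to-root (inleft i) with to-root i
... | l , r , ρs = _ , _ , gmap (λ t → node t _ _) inleft ρs ◅◅ (rotateʳ ◅ ε)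
to-root (inright i) with to-root i
... | l , r , ρs = _ , _ , gmap (λ t → node _ _ t) inright ρs ◅◅ (rotateˡ ◅ ε)

-- The root of `B` is rotated to the top, and recursion shapes both sides. Keys of `A` that `B`
-- lacks end up below, in the places of its leaves, and so do not disturb depths in `B`.
reshape : ∀ {B A : KeyTree n} → Ordered B → Ordered A → (∀ {v} → v ∈ₜ B → v ∈ₜ A) →
          ∃[ A′ ] (A ⟶* A′) × (∀ {v} → v ∈ₜ B → depth A′ v ≡ depth B v)
reshape {B = leaf _} {A} _ _ _ = A , ε , λ ()
reshape {B = node l k r} oB@(node l< r> ol or) oA B⊆A with to-root (B⊆A here)
... | Al , Ar , ρs with Ordered-⟶* ρs oA
...   | o@(node _ _ oAl oAr)
  with reshape ol oAl (λ i → ∈-left o (lookup l< i) (∈ₜ-resp _ (inorder-⟶* ρs) (B⊆A (inleft i))))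
     | reshape or oAr (λ i → ∈-right o (lookup r> i) (∈ₜ-resp _ (inorder-⟶* ρs) (B⊆A (inright i))))
... | l′ , ρl , dl | r′ , ρr , dr =
  node l′ k r′ , ρs ◅◅ (gmap (λ t → node t k _) inleft ρl ◅◅ gmap (node l′ k) inright ρr) , same
  where
  same : ∀ {v} → v ∈ₜ node l k r → depth (node l′ k r′) v ≡ depth (node l k r) v
  same {v} i with <-cmp v k
  ... | tri< v<k _ _ = cong suc (dl (∈-left oB v<k i))
  ... | tri≈ _ _ _   = refl
  ... | tri> _ _ k<v = cong suc (dr (∈-right oB k<v i))

-- Alternating queries

alternate : {A : Set} → List A → List A → List A
alternate []       ys = ys
alternate (x ∷ xs) ys = x ∷ alternate ys xs

module _ {A : Set} where

  All-alternate : {P : Pred A 0ℓ} → ∀ {xs ys} → All P xs → All P ys → All P (alternate xs ys)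
  All-alternate []       qs = qs
  All-alternate (p ∷ ps) qs = p ∷ All-alternate qs ps

  length-alternate : ∀ (xs ys : List A) → length (alternate xs ys) ≡ length xs + length ys
  length-alternate []       ys = refl
  length-alternate (x ∷ xs) ys = cong suc (trans (length-alternate ys xs) (ℕ.+-comm (length ys) _))

  sum-alternate : ∀ (f : A → ℕ) xs ys → sum (map f (alternate xs ys)) ≡ sum (map f xs) + sum (map f ys)
  sum-alternate f []       ys = refl
  sum-alternate f (x ∷ xs) ys = trans (cong (f x +_) (trans (sum-alternate f ys xs) (ℕ.+-comm (sum (map f ys)) _)))
    (sym (ℕ.+-assoc (f x) _ _))

  filter-alternateˡ : {P : Pred A 0ℓ} (P? : Decidable P) → ∀ {xs ys} → All P xs → All (¬_ ∘ P) ys →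
                      filter P? (alternate xs ys) ≡ xs
  filter-alternateʳ : {P : Pred A 0ℓ} (P? : Decidable P) → ∀ {xs ys} → All (¬_ ∘ P) xs → All P ys →
                      filter P? (alternate xs ys) ≡ ys
  filter-alternateˡ P? []       qs = filter-none P? qs
  filter-alternateˡ P? (p ∷ ps) qs = trans (filter-accept P? p) (cong (_ ∷_) (filter-alternateʳ P? qs ps))
  filter-alternateʳ P? []       qs = filter-all P? qs
  filter-alternateʳ P? (p ∷ ps) qs = trans (filter-reject P? p) (filter-alternateˡ P? qs ps)

  sum-replicate : ∀ (f : A → ℕ) m x → sum (map f (replicate m x)) ≡ m * f x
  sum-replicate f zero    x = refl
  sum-replicate f (suc m) x = cong (f x +_) (sum-replicate f m x)

  sum-≤ : ∀ {f g : A → ℕ} d {xs} → All (λ x → f x ≤ d + g x) xs → sum (map f xs) ≤ d * length xs + sum (map g xs)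
  sum-≤ d [] = z≤n
  sum-≤ {f} {g} d {x ∷ xs} (p ∷ ps) = ℕ.≤-trans (ℕ.+-mono-≤ p (sum-≤ d ps))
    (ℕ.≤-reflexive (rearrange d (length xs) (g x) (sum (map g xs))))
    where
    rearrange : ∀ d l a b → d + a + (d * l + b) ≡ d * suc l + (a + b)
    rearrange = solve-∀

  sum-suc : ∀ {f g : A → ℕ} {xs} → All (λ x → f x ≡ suc (g x)) xs → sum (map f xs) ≡ length xs + sum (map g xs)
  sum-suc [] = refl
  sum-suc {f} {g} {x ∷ xs} (p ∷ ps) = trans (cong₂ _+_ p (sum-suc ps)) (cong suc (rearrange (g x) (length xs) _))
    where
    rearrange : ∀ a l b → a + (l + b) ≡ l + (a + b)
    rearrange = solve-∀

-- Equal lengths prevent one list from running out early, which would leave several queries in a row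
-- on one side.
alternates-alternate : ∀ {k : Fin n} {xs ys} → All (_< k) xs → All (k <_) ys → length xs ≡ length ys →
                       Alternates k (alternate xs ys)
alternates-alternate {k = k} []       []       _  = []
alternates-alternate {k = k} (p ∷ ps) (q ∷ qs) eq = (opposite p q) ∷ after q ps qs (ℕ.suc-injective eq)
  where
  opposite : ∀ {x y} → x < k → k < y → Opposite k x y
  opposite x<k k<y = (λ (_ , y<k) → <-asym y<k k<y) , λ (k<x , _) → <-asym x<k k<x
  after : ∀ {y xs ys} → k < y → All (_< k) xs → All (k <_) ys → length xs ≡ length ys →
          Alternates k (y ∷ alternate xs ys)
  after _   []       []       _  = [-]
  after k<y (p ∷ ps) (q ∷ qs) eq =
    ((λ (y<k , _) → <-asym y<k k<y) , λ (_ , k<x) → <-asym p k<x) ∷ opposite p q ∷ after q ps qs (ℕ.suc-injective eq)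

height : Alpha n → ℕ
height (tip _)      = 0
height (fork l _ r) = suc (height l ⊔ height r)

height-fork : ∀ {l r : Alpha n} {k h} → height (fork l k r) ≤ suc h → height l ≤ h × height r ≤ h
height-fork {l = l} {r} (s≤s p) = ℕ.m⊔n≤o⇒m≤o (height l) (height r) p , ℕ.m⊔n≤o⇒n≤o (height l) (height r) p

-- In every subtree the queries of rot T h go left and right in turn.
rot : Alpha n → ℕ → List (Fin n)
rot (tip q)      h       = replicate (2 ^ h) q
-- A default value: `rot T h` is meant for `height T ≤ h`.
rot (fork l k r) zero    = []
rot (fork l k r) (suc h) = alternate (rot l h) (rot r h)

rot-length : ∀ (T : Alpha n) {h} → height T ≤ h → length (rot T h) ≡ 2 ^ h
rot-length (tip q)      _ = length-replicate _
rot-length (fork l k r) {suc h} ht with height-fork {l = l} {r} {k} ht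
... | hl , hr = trans (length-alternate (rot l h) (rot r h))
  (cong₂ _+_ (rot-length l hl) (trans (rot-length r hr) (sym (ℕ.+-identityʳ _))))

rot-range : ∀ {T : Alpha n} {lo hi} → Within lo hi T → ∀ h → All (InRange lo hi) (rot T h)
rot-range (tip p q) h = All.replicate⁺ (2 ^ h) (p , q)
rot-range (fork _ _ _ _) zero = []
rot-range (fork lo≤k k<hi wl wr) (suc h) = All-alternate
  (All.map (λ (p , q) → p , ℕ.<-trans q k<hi) (rot-range wl h))
  (All.map (λ (p , q) → ℕ.≤-trans lo≤k (ℕ.<⇒≤ p) , q) (rot-range wr h))

rot-∉ᶠ : ∀ {T : Alpha n} {lo hi} → Within lo hi T → ∀ h → All (λ x → ¬ (x ∈ᶠ T)) (rot T h)
rot-∉ᶠ (tip p q) h = All.replicate⁺ (2 ^ h) λ ()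
rot-∉ᶠ (fork _ _ _ _) zero = []
rot-∉ᶠ {T = fork l k r} (fork lo≤k k<hi wl wr) (suc h) = All-alternate
  (All.zipWith (λ { ((_ , x<k) , _) here → <-irrefl {x = k} refl x<k
                  ; (_ , x∉) (inleft i) → x∉ i
                  ; ((_ , x<k) , _) (inright i) → ℕ.<-asym x<k (proj₁ (∈ᶠ-range wr i)) }) (rot-range wl h , rot-∉ᶠ wl h))
  (All.zipWith (λ { ((k<x , _) , _) here → <-irrefl {x = k} refl k<x
                  ; ((k<x , _) , _) (inleft i) → ℕ.<-asym k<x (proj₂ (∈ᶠ-range wl i))
                  ; (_ , x∉) (inright i) → x∉ i }) (rot-range wr h , rot-∉ᶠ wr h))

-- Filtering by the side of `k` undoes `alternate`, and both halves have length `2 ^ h`.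
steady-rot : ∀ {T : Alpha n} {lo hi h} → Within lo hi T → height T ≤ h → Steady T (rot T h)
steady-rot (tip _ _) _ = tt
steady-rot {T = fork l k r} {h = suc h} (fork _ _ wl wr) ht with height-fork {l = l} {r} {k} ht
... | hl , hr =
    alternates-alternate l<k k<r (trans (rot-length l hl) (sym (rot-length r hr)))
  , subst (Steady l) (sym (filter-alternateˡ (_<? k) l<k (All.map <-asym k<r))) (steady-rot wl hl)
  , subst (Steady r) (sym (filter-alternateʳ (k <?_) (All.map <-asym l<k) k<r)) (steady-rot wr hr)
  where
  l<k : All (_< k) (rot l h)
  l<k = All.map proj₂ (rot-range wl h)
  k<r : All (k <_) (rot r h)
  k<r = All.map proj₁ (rot-range wr h)

length-weave : ∀ {A : Set} (k : A) xs → length (weave k xs) ≡ 2 * length xs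
length-weave k []       = refl
length-weave k (x ∷ xs) = trans (cong (2 +_) (length-weave k xs)) (rearrange (length xs))
  where
  rearrange : ∀ l → 2 + 2 * l ≡ 2 * suc l
  rearrange = solve-∀

-- Each level doubles by weaving and doubles again by having two children. The summand 2 absorbs the
-- two leading queries of `k` in the induction.
setup-length : ∀ (T : Alpha n) {h} → height T ≤ h → 2 + length (setup T) ≤ 2 * 4 ^ h
setup-length (tip q) {h} _ = ℕ.*-monoʳ-≤ 2 (ℕ.m^n>0 4 h)
setup-length (fork l k r) {suc h} ht
  rewrite length-weave k (setup l ++ setup r) | length-++ (setup l) {setup r} with height-fork {l = l} {r} {k} ht
... | hl , hr = ℕ.≤-trans (ℕ.m≤m+n _ 4) (subst₂ _≤_ (left (length (setup l)) (length (setup r))) (right (4 ^ h))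
  (ℕ.*-monoʳ-≤ 2 (ℕ.+-mono-≤ (setup-length l hl) (setup-length r hr))))
  where
  left : ∀ a b → 2 * (2 + a + (2 + b)) ≡ 2 + (2 + 2 * (a + b)) + 4
  left = solve-∀
  right : ∀ p → 2 * (2 * p + 2 * p) ≡ 2 * (4 * p)
  right = solve-∀

-- The trees T(K) and B(K)

depth-root : ∀ {k : Fin n} {l r} → depth (node l k r) k ≡ 1
depth-root {k = k} with <-cmp k k
... | tri< k<k _ _ = ⊥-elim (<-irrefl refl k<k)
... | tri≈ _ _ _   = refl
... | tri> _ _ k<k = ⊥-elim (<-irrefl refl k<k)

depth-left : ∀ {x k : Fin n} {l r} → x < k → depth (node l k r) x ≡ suc (depth l x)
depth-left {x = x} {k} x<k with <-cmp x k
... | tri< _ _ _   = refl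
... | tri≈ x≮k _ _ = ⊥-elim (x≮k x<k)
... | tri> x≮k _ _ = ⊥-elim (x≮k x<k)

depth-right : ∀ {x k : Fin n} {l r} → k < x → depth (node l k r) x ≡ suc (depth r x)
depth-right {x = x} {k} k<x with <-cmp x k
... | tri> _ _ _   = refl
... | tri≈ _ _ x≯k = ⊥-elim (x≯k k<x)
... | tri< _ _ x≯k = ⊥-elim (x≯k k<x)

data Bounded {n : ℕ} (lo hi : ℕ) : KeyTree n → Set where
  leaf : Bounded lo hi (leaf tt)
  node : ∀ {l k r} → lo ≤ toℕ k → toℕ k ℕ.< hi →
         Bounded lo (toℕ k) l → Bounded (suc (toℕ k)) hi r → Bounded lo hi (node l k r)

bounded-mono : ∀ {lo hi lo′ hi′} {B : KeyTree n} → lo′ ≤ lo → hi ≤ hi′ → Bounded lo hi B → Bounded lo′ hi′ B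
bounded-mono p q leaf = leaf
bounded-mono p q (node a b bl br) =
  node (ℕ.≤-trans p a) (ℕ.<-≤-trans b q) (bounded-mono p ℕ.≤-refl bl) (bounded-mono ℕ.≤-refl q br)

bounded⇒All : ∀ {lo hi} {B : KeyTree n} → Bounded lo hi B → TreeAll.All (InRange lo hi) (λ _ → Unit) B
bounded⇒All leaf = TreeAll.leaf tt
bounded⇒All (node a b bl br) = TreeAll.node
  (TreeAll.mapₙ (λ (p , q) → p , ℕ.<-trans q b) (bounded⇒All bl)) (a , b)
  (TreeAll.mapₙ (λ (p , q) → ℕ.≤-trans a (ℕ.<⇒≤ p) , q) (bounded⇒All br))

bounded⇒Ordered : ∀ {lo hi} {B : KeyTree n} → Bounded lo hi B → Ordered B
bounded⇒Ordered leaf = leaf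
bounded⇒Ordered (node _ _ bl br) = node (TreeAll.mapₙ proj₂ (bounded⇒All bl)) (TreeAll.mapₙ proj₁ (bounded⇒All br))
  (bounded⇒Ordered bl) (bounded⇒Ordered br)

tree-cost : Alpha n → ℕ → ℕ
tree-cost T h = sum (map (depth (toTree T)) (rot T h))

fork-cost : ∀ {l r : Alpha n} {k lo hi h} → Within lo hi (fork l k r) → height l ≤ h → height r ≤ h →
            tree-cost (fork l k r) (suc h) ≡ 2 ^ suc h + (tree-cost l h + tree-cost r h)
fork-cost {l = l} {r} {k} {h = h} (fork _ _ wl wr) hl hr = trans (sum-alternate (depth (toTree (fork l k r))) (rot l h) (rot r h))
  (trans (cong₂ _+_
    (trans (sum-suc (All.map (λ (_ , x<k) → depth-left x<k) (rot-range wl h))) (cong (_+ tree-cost l h) (rot-length l hl)))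
    (trans (sum-suc (All.map (λ (k<x , _) → depth-right k<x) (rot-range wr h))) (cong (_+ tree-cost r h) (rot-length r hr))))
    (rearrange (2 ^ h) (tree-cost l h) (tree-cost r h)))
  where
  rearrange : ∀ p a b → p + a + (p + b) ≡ 2 * p + (a + b)
  rearrange = solve-∀

tip-cost : ∀ (q : Fin n) h → tree-cost (tip q) h ≡ 2 ^ h
tip-cost q h = trans (sum-replicate _ (2 ^ h) q) (trans (cong (2 ^ h *_) depth-root) (ℕ.*-identityʳ _))

-- α / A bounds from below the average saving per query; the scale A avoids fractions.
Gain : ℕ → ℕ → KeyTree n → Alpha n → ℕ → Set
Gain A α B T h = A * sum (map (depth B) (rot T h)) + α * 2 ^ h ≤ A * tree-cost T h

-- `T` is forced upon Greedy Future, and `B` is the tree in which the competitor rests. The gain is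
-- asked for at every `h` from `ht` on, because copies of one pair hang at different depths and
-- receive different numbers of queries.
record Pair (A α ht lo hi : ℕ) (T : Alpha n) (B : KeyTree n) : Set where
  field
    within  : Within lo hi T
    bounded : Bounded lo hi B
    low     : height T ≤ ht
    served  : ∀ h → All (_∈ₜ B) (rot T h)
    gain    : ∀ h → ht ≤ h → Gain A α B T h

-- Here `f` is the depth in a larger tree where `B` hangs at most `d` levels down, which costs each
-- query at most `d` more.
gain-below : ∀ {A α ht lo hi} {T : Alpha n} {B f} d h → Pair A α ht lo hi T B → ht ≤ h →
             All (λ x → f x ≤ d + depth B x) (rot T h) →
             A * sum (map f (rot T h)) + α * 2 ^ h ≤ A * (d * 2 ^ h) + A * tree-cost T h
gain-below {A = A} {α} {T = T} {B} {f} d h pair ht≤h f≤ = begin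
  A * sum (map f (rot T h)) + α * 2 ^ h
    ≤⟨ ℕ.+-monoˡ-≤ (α * 2 ^ h) (ℕ.*-monoʳ-≤ A (subst (λ z → sum (map f (rot T h)) ≤ d * z + sum (map (depth B) (rot T h)))
         (rot-length T (ℕ.≤-trans low ht≤h)) (sum-≤ d f≤))) ⟩
  A * (d * 2 ^ h + sum (map (depth B) (rot T h))) + α * 2 ^ h
    ≡⟨ rearrange A (d * 2 ^ h) _ _ ⟩
  A * (d * 2 ^ h) + (A * sum (map (depth B) (rot T h)) + α * 2 ^ h)
    ≤⟨ ℕ.+-monoʳ-≤ (A * (d * 2 ^ h)) (gain h ht≤h) ⟩
  A * (d * 2 ^ h) + A * tree-cost T h ∎
  where
  open Pair pair
  open ℕ.≤-Reasoning
  rearrange : ∀ A a b c → A * (a + b) + c ≡ A * a + (A * b + c)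
  rearrange = solve-∀

combSize : ℕ → ℕ → ℕ
combSize N zero    = 2 + N
combSize N (suc j) = suc N + combSize N j

towerSize : ℕ → ℕ → ℕ
towerSize e zero    = 3
-- The left copy and the root key of `nextT` take up as many keys as one more tooth of the comb.
towerSize e (suc K) = combSize (towerSize e K) (suc e)

module Construction {n : ℕ} (key : ℕ → Fin n) (toℕ-key : ∀ {i} → i ℕ.< n → toℕ (key i) ≡ i) where

  -- The key at p is a tip at the bottom of the comb combT j p, and is missing from combB j p.
  module _ (N : ℕ) (t : ℕ → Alpha n) where

    combT : ℕ → ℕ → Alpha n
    combT zero    p = fork (tip (key p)) (key (1 + p)) (t (2 + p))
    combT (suc j) p = fork (combT j p) (key (combSize N j + p)) (t (suc (combSize N j + p)))

    nextT : ℕ → ℕ → Alpha n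
    nextT e o = fork (t o) (key (N + o)) (combT e (suc (N + o)))

  module _ (N : ℕ) (b : ℕ → KeyTree n) where

    combB : ℕ → ℕ → KeyTree n
    -- Without the tip the bottom fork disappears, and the lowest copy moves up by one level.
    combB zero    p = b (2 + p)
    combB (suc j) p = node (combB j p) (key (combSize N j + p)) (b (suc (combSize N j + p)))

    nextB : ℕ → ℕ → KeyTree n
    nextB e o = node (b o) (key (suc (N + o))) (combB e (suc (N + o)))

  module Comb (N : ℕ) (t : ℕ → Alpha n) (b : ℕ → KeyTree n) where
    private
      size = combSize N

    module _ {A α ht : ℕ} (pairs : ∀ o → N + o ≤ n → Pair A α ht o (N + o) (t o) (b o)) where

      -- In `gain`, `f` is the depth in a tree with `key p` at the root and the comb at most `d`
      -- levels down. Relative to a shift of every query by `d`, each of the `2 ^ h` queries of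
      -- `key p` saves `j + 1 + d`, and each of the `2 ^ h` queries in the lowest copy saves one
      -- more: together the factor `j + 2 + d`. The term `α * 2 ^ h` on the right arises since
      -- `key p` lies in no copy and has no gain `α` of its own.
      record CombPair (j p : ℕ) : Set where
        field
          within  : Within p (size j + p) (combT N t j p)
          bounded : Bounded (suc p) (size j + p) (combB N b j p)
          low     : height (combT N t j p) ≤ suc j + ht
          served  : ∀ h → All (λ x → x ≡ key p ⊎ x ∈ₜ combB N b j p) (rot (combT N t j p) h)
          gain    : ∀ (f : Fin n → ℕ) d h → ht ≤ h → f (key p) ≤ 1 →
                    (∀ {x} → InRange (suc p) (size j + p) x → f x ≤ d + depth (combB N b j p) x) →
                    A * sum (map f (rot (combT N t j p) (j + suc h))) + α * 2 ^ (j + suc h) + A * ((j + 2 + d) * 2 ^ h)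
                    ≤ A * (d * 2 ^ (j + suc h)) + A * tree-cost (combT N t j p) (j + suc h) + α * 2 ^ h

      private
        rearrange-size : ∀ N s p → suc N + s + p ≡ N + suc (s + p)
        rearrange-size = solve-∀

        size≥1 : ∀ j → 1 ≤ size j
        size≥1 zero    = s≤s z≤n
        size≥1 (suc j) = s≤s z≤n

      combPair : ∀ j p → size j + p ≤ n → CombPair j p
      combPair zero p fits = record
        { within  = within
        ; bounded = bounded-mono (ℕ.n≤1+n _) (ℕ.≤-reflexive N+2+p) (Pair.bounded P)
        ; low     = s≤s (Pair.low P)
        ; served  = served
        ; gain    = gain
        }
        where
        N+2+p : N + (2 + p) ≡ 2 + N + p
        N+2+p = lemma N p
          where
          lemma : ∀ N p → N + (2 + p) ≡ 2 + N + p
          lemma = solve-∀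
        P : Pair A α ht (2 + p) (N + (2 + p)) (t (2 + p)) (b (2 + p))
        P = pairs (2 + p) (subst (_≤ n) (sym N+2+p) fits)
        p+1<end : suc p ℕ.< 2 + N + p
        p+1<end = s≤s (s≤s (ℕ.m≤n+m p N))
        key-p : toℕ (key p) ≡ p
        key-p = toℕ-key (ℕ.<-≤-trans (ℕ.<-trans (ℕ.n<1+n p) p+1<end) fits)
        key-1+p : toℕ (key (1 + p)) ≡ 1 + p
        key-1+p = toℕ-key (ℕ.<-≤-trans p+1<end fits)
        within : Within p (2 + N + p) (combT N t zero p)
        within = fork (subst (p ≤_) (sym key-1+p) (ℕ.n≤1+n p)) (subst (ℕ._< 2 + N + p) (sym key-1+p) p+1<end)
          (tip (ℕ.≤-reflexive (sym key-p)) (subst₂ ℕ._<_ (sym key-p) (sym key-1+p) (ℕ.n<1+n p)))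
          (subst₂ (λ lo hi → Within lo hi (t (2 + p))) (cong suc (sym key-1+p)) N+2+p (Pair.within P))
        served : ∀ h → All (λ x → x ≡ key p ⊎ x ∈ₜ b (2 + p)) (rot (combT N t zero p) h)
        served zero    = []
        served (suc h) = All-alternate (All.replicate⁺ (2 ^ h) (inj₁ refl)) (All.map inj₂ (Pair.served P h))
        gain : ∀ (f : Fin n → ℕ) d h → ht ≤ h → f (key p) ≤ 1 →
               (∀ {x} → InRange (suc p) (2 + N + p) x → f x ≤ d + depth (b (2 + p)) x) →
               A * sum (map f (rot (combT N t zero p) (suc h))) + α * 2 ^ suc h + A * ((2 + d) * 2 ^ h)
               ≤ A * (d * 2 ^ suc h) + A * tree-cost (combT N t zero p) (suc h) + α * 2 ^ h
        gain f d h ht≤h f≤1 f≤ = begin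
          A * sum (map f (rot (combT N t zero p) (suc h))) + α * 2 ^ suc h + A * ((2 + d) * q)
            ≡⟨ cong (λ z → A * z + α * 2 ^ suc h + A * ((2 + d) * q))
                 (sum-alternate f (rot (tip (key p)) h) (rot (t (2 + p)) h)) ⟩
          A * (sum (map f (replicate q (key p))) + F) + α * 2 ^ suc h + A * ((2 + d) * q)
            ≤⟨ ℕ.+-monoˡ-≤ (A * ((2 + d) * q)) (ℕ.+-monoˡ-≤ (α * 2 ^ suc h) (ℕ.*-monoʳ-≤ A (ℕ.+-monoˡ-≤ F
                 (ℕ.≤-trans (ℕ.≤-reflexive (sum-replicate f q (key p))) (ℕ.*-monoʳ-≤ q f≤1))))) ⟩
          A * (q * 1 + F) + α * 2 ^ suc h + A * ((2 + d) * q)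
            ≡⟨ before A α d q F ⟩
          A * F + α * q + (A * ((3 + d) * q) + α * q)
            ≤⟨ ℕ.+-monoˡ-≤ (A * ((3 + d) * q) + α * q) (gain-below d h P ht≤h (All.map
                 (λ {x} (lo , hi) → f≤ (ℕ.<⇒≤ lo , subst (toℕ x ℕ.<_) N+2+p hi)) (rot-range (Pair.within P) h))) ⟩
          A * (d * q) + A * D + (A * ((3 + d) * q) + α * q)
            ≡⟨ after A α d q D ⟩
          A * (d * 2 ^ suc h) + A * (2 ^ suc h + (q + D)) + α * q
            ≡⟨ cong (λ z → A * (d * 2 ^ suc h) + A * z + α * q) (sym (trans
                 (fork-cost within z≤n (ℕ.≤-trans (Pair.low P) ht≤h))
                 (cong (λ z → 2 ^ suc h + (z + D)) (tip-cost (key p) h)))) ⟩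
          A * (d * 2 ^ suc h) + A * tree-cost (combT N t zero p) (suc h) + α * q ∎
          where
          open ℕ.≤-Reasoning
          q = 2 ^ h
          F = sum (map f (rot (t (2 + p)) h))
          D = tree-cost (t (2 + p)) h
          before : ∀ A α d q F → A * (q * 1 + F) + α * (2 * q) + A * ((2 + d) * q)
                                 ≡ A * F + α * q + (A * ((3 + d) * q) + α * q)
          before = solve-∀
          after : ∀ A α d q D → A * (d * q) + A * D + (A * ((3 + d) * q) + α * q)
                                ≡ A * (d * (2 * q)) + A * (2 * q + (q + D)) + α * q
          after = solve-∀
      combPair (suc j) p fits = record
        { within  = within
        ; bounded = node (subst (suc p ≤_) (sym key-s) (ℕ.+-monoˡ-≤ p (size≥1 j))) (subst (ℕ._< suc N + size j + p) (sym key-s) s<end)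
                      (subst (λ hi → Bounded (suc p) hi (combB N b j p)) (sym key-s) (CombPair.bounded C))
                      (subst₂ (λ lo hi → Bounded lo hi (b (suc s))) (cong suc (sym key-s)) (sym end) (Pair.bounded P))
        ; low     = s≤s (ℕ.⊔-lub (CombPair.low C) (ℕ.≤-trans (Pair.low P) (ℕ.m≤n+m ht (suc j))))
        ; served  = λ { zero → []
                      ; (suc h) → All-alternate
                          (All.map [ inj₁ , inj₂ ∘ inleft ]′ (CombPair.served C h))
                          (All.map (inj₂ ∘ inright) (Pair.served P h)) }
        ; gain    = gain
        }
        where
        s = size j + p
        end : suc N + size j + p ≡ N + suc s
        end = rearrange-size N (size j) p
        C : CombPair j p
        C = combPair j p (ℕ.≤-trans (ℕ.≤-trans (ℕ.n≤1+n s) (ℕ.m≤n+m (suc s) N)) (subst (_≤ n) end fits))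
        P : Pair A α ht (suc s) (N + suc s) (t (suc s)) (b (suc s))
        P = pairs (suc s) (subst (_≤ n) end fits)
        s<end : s ℕ.< suc N + size j + p
        s<end = subst (s ℕ.<_) (sym end) (ℕ.m≤n+m (suc s) N)
        key-s : toℕ (key s) ≡ s
        key-s = toℕ-key (ℕ.<-≤-trans s<end fits)
        within : Within p (suc N + size j + p) (combT N t (suc j) p)
        within = fork (subst (p ≤_) (sym key-s) (ℕ.m≤n+m p (size j))) (subst (ℕ._< suc N + size j + p) (sym key-s) s<end)
          (subst (λ hi → Within p hi (combT N t j p)) (sym key-s) (CombPair.within C))
          (subst₂ (λ lo hi → Within lo hi (t (suc s))) (cong suc (sym key-s)) (sym end) (Pair.within P))
        gain : ∀ (f : Fin n → ℕ) d h → ht ≤ h → f (key p) ≤ 1 →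
               (∀ {x} → InRange (suc p) (suc N + size j + p) x → f x ≤ d + depth (combB N b (suc j) p) x) →
               A * sum (map f (rot (combT N t (suc j) p) (suc (j + suc h)))) + α * 2 ^ suc (j + suc h) + A * ((suc j + 2 + d) * 2 ^ h)
               ≤ A * (d * 2 ^ suc (j + suc h)) + A * tree-cost (combT N t (suc j) p) (suc (j + suc h)) + α * 2 ^ h
        gain f d h ht≤h f≤1 f≤ = begin
          A * sum (map f (rot (combT N t (suc j) p) (suc h₁))) + α * 2 ^ suc h₁ + A * ((suc j + 2 + d) * q)
            ≡⟨ cong (λ z → A * z + α * 2 ^ suc h₁ + A * ((suc j + 2 + d) * q))
                 (sum-alternate f (rot (combT N t j p) h₁) (rot (t (suc s)) h₁)) ⟩
          A * (G + F) + α * 2 ^ suc h₁ + A * ((suc j + 2 + d) * q)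
            ≡⟨ before A α d j q q₁ F G ⟩
          A * G + α * q₁ + A * ((j + 2 + suc d) * q) + (A * F + α * q₁)
            -- Below the root of the comb the offset `d` becomes `suc d`, and `j + 2 + suc d` is the
            -- saving claimed for `suc j`.
            ≤⟨ ℕ.+-mono-≤
                 (CombPair.gain C f (suc d) h ht≤h f≤1 λ {x} (lo , hi) → subst (f x ≤_)
                   (trans (cong (d +_) (depth-left {k = key s} (subst (toℕ x ℕ.<_) (sym key-s) hi))) (ℕ.+-suc d _))
                   (f≤ (lo , ℕ.<-trans hi s<end)))
                 (gain-below (suc d) h₁ P ht≤h₁ (All.map (λ {x} (lo , hi) → subst (f x ≤_)
                   (trans (cong (d +_) (depth-right {k = key s} (subst (ℕ._< toℕ x) (sym key-s) lo))) (ℕ.+-suc d _))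
                   (f≤ (ℕ.≤-trans (s≤s (ℕ.m≤n+m p (size j))) lo , subst (toℕ x ℕ.<_) (sym end) hi)))
                   (rot-range (Pair.within P) h₁))) ⟩
          A * (suc d * q₁) + A * E + α * q + (A * (suc d * q₁) + A * D)
            ≡⟨ after A α d q q₁ D E ⟩
          A * (d * 2 ^ suc h₁) + A * (2 ^ suc h₁ + (E + D)) + α * q
            ≡⟨ cong (λ z → A * (d * 2 ^ suc h₁) + A * z + α * q) (sym (fork-cost within
                 (ℕ.≤-trans (CombPair.low C) (subst (suc j + ht ≤_) (sym (ℕ.+-suc j h)) (s≤s (ℕ.+-monoʳ-≤ j ht≤h))))
                 (ℕ.≤-trans (Pair.low P) ht≤h₁))) ⟩
          A * (d * 2 ^ suc h₁) + A * tree-cost (combT N t (suc j) p) (suc h₁) + α * q ∎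
          where
          open ℕ.≤-Reasoning
          h₁ = j + suc h
          ht≤h₁ : ht ≤ h₁
          ht≤h₁ = ℕ.≤-trans ht≤h (ℕ.≤-trans (ℕ.n≤1+n h) (ℕ.m≤n+m (suc h) j))
          q = 2 ^ h
          q₁ = 2 ^ h₁
          F = sum (map f (rot (t (suc s)) h₁))
          G = sum (map f (rot (combT N t j p) h₁))
          D = tree-cost (t (suc s)) h₁
          E = tree-cost (combT N t j p) h₁
          before : ∀ A α d j q q₁ F G → A * (G + F) + α * (2 * q₁) + A * ((suc j + 2 + d) * q)
                                        ≡ A * G + α * q₁ + A * ((j + 2 + suc d) * q) + (A * F + α * q₁)
          before = solve-∀
          after : ∀ A α d q q₁ D E → A * (suc d * q₁) + A * E + α * q + (A * (suc d * q₁) + A * D)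
                                     ≡ A * (d * (2 * q₁)) + A * (2 * q₁ + (E + D)) + α * q
          after = solve-∀

      -- The left copy is one level down in both trees. A fraction `2 ^ -(2 + e)` of the queries
      -- goes to the additional key and equally many to the lowest copy; with offset 1 they save
      -- `e + 3` together, while the additional key forgoes `α`. The last hypothesis is this balance
      -- multiplied by `2 ^ (2 + e)`.
      nextPair : ∀ {α′} e o → combSize N (suc e) + o ≤ n → α′ * 2 ^ (2 + e) + α ≤ α * 2 ^ (2 + e) + A * (3 + e) →
                 Pair A α′ (2 + e + ht) o (combSize N (suc e) + o) (nextT N t e o) (nextB N b e o)
      nextPair {α′} e o fits α′≤ = record
        { within  = within
        ; bounded = node (subst (o ≤_) (sym key-c) (ℕ.≤-trans o≤s (ℕ.n≤1+n s)))
                      (subst (ℕ._< suc N + size e + o) (sym key-c) (subst (suc s ℕ.<_) (sym end) (ℕ.+-monoˡ-≤ (suc s) (size≥1 e))))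
                      (bounded-mono ℕ.≤-refl (subst (s ≤_) (sym key-c) (ℕ.n≤1+n s)) (Pair.bounded P))
                      (subst₂ (λ lo hi → Bounded lo hi (combB N b e (suc s))) (cong suc (sym key-c)) (sym end) (CombPair.bounded C))
        ; low     = s≤s (ℕ.⊔-lub (ℕ.≤-trans (Pair.low P) (ℕ.m≤n+m ht (suc e))) (CombPair.low C))
        ; served  = λ { zero → []
                      ; (suc h) → All-alternate (All.map inleft (Pair.served P h))
                          (All.map (λ { (inj₁ refl) → here ; (inj₂ i) → inright i }) (CombPair.served C h)) }
        ; gain    = gain
        }
        where
        s = N + o
        o≤s : o ≤ s
        o≤s = ℕ.m≤n+m o N
        end : suc N + size e + o ≡ size e + suc s
        end = lemma N (size e) o
          where
          lemma : ∀ N s o → suc N + s + o ≡ s + suc (N + o)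
          lemma = solve-∀
        s+1≤end : suc s ≤ suc N + size e + o
        s+1≤end = subst (suc s ≤_) (sym end) (ℕ.m≤n+m (suc s) (size e))
        s+1<end : suc s ℕ.< suc N + size e + o
        s+1<end = subst (suc s ℕ.<_) (sym end) (ℕ.+-monoˡ-≤ (suc s) (size≥1 e))
        P : Pair A α ht o s (t o) (b o)
        P = pairs o (ℕ.≤-trans (ℕ.n≤1+n s) (ℕ.≤-trans s+1≤end fits))
        C : CombPair e (suc s)
        C = combPair e (suc s) (subst (_≤ n) end fits)
        key-s : toℕ (key s) ≡ s
        key-s = toℕ-key (ℕ.≤-trans s+1≤end fits)
        key-c : toℕ (key (suc s)) ≡ suc s
        key-c = toℕ-key (ℕ.<-≤-trans s+1<end fits)
        within : Within o (suc N + size e + o) (nextT N t e o)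
        within = fork (subst (o ≤_) (sym key-s) o≤s) (subst (ℕ._< suc N + size e + o) (sym key-s) s+1≤end)
          (subst (λ hi → Within o hi (t o)) (sym key-s) (Pair.within P))
          (subst₂ (λ lo hi → Within lo hi (combT N t e (suc s))) (cong suc (sym key-s)) (sym end) (CombPair.within C))
        T = nextT N t e o
        f = depth (nextB N b e o)
        gain′ : ∀ h → ht ≤ h → Gain A α′ (nextB N b e o) T (suc (e + suc h))
        -- `α * q` is the gain forgone by the `q` queries of the additional key.
        gain′ h ht≤h = ℕ.+-cancelʳ-≤ (α * q) _ _ (begin
          A * sum (map f (rot T (suc h₁))) + α′ * 2 ^ suc h₁ + α * q
            ≡⟨ cong (λ z → A * sum (map f (rot T (suc h₁))) + α′ * z + α * q) pow ⟩
          A * sum (map f (rot T (suc h₁))) + α′ * (R * q) + α * q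
            ≡⟨ weights A α α′ R q (sum (map f (rot T (suc h₁)))) ⟩
          A * sum (map f (rot T (suc h₁))) + (α′ * R + α) * q
            ≤⟨ ℕ.+-monoʳ-≤ (A * sum (map f (rot T (suc h₁)))) (ℕ.*-monoˡ-≤ q α′≤) ⟩
          A * sum (map f (rot T (suc h₁))) + (α * R + A * (3 + e)) * q
            ≡⟨ cong (λ z → A * z + (α * R + A * (3 + e)) * q) (sum-alternate f (rot (t o) h₁) (rot (combT N t e (suc s)) h₁)) ⟩
          A * (F + G) + (α * R + A * (3 + e)) * q
            ≡⟨ before A α e q R F G ⟩
          A * F + A * G + α * (R * q) + A * ((3 + e) * q)
            ≡⟨ cong (λ z → A * F + A * G + α * z + A * ((3 + e) * q)) (sym pow) ⟩
          A * F + A * G + α * (2 * q₁) + A * ((3 + e) * q)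
            ≡⟨ split A α e q q₁ F G ⟩
          A * F + α * q₁ + (A * G + α * q₁ + A * ((e + 2 + 1) * q))
            ≤⟨ ℕ.+-mono-≤
                 (gain-below 1 h₁ P ht≤h₁ (All.map (λ {x} (_ , hi) → ℕ.≤-reflexive
                   (depth-left (subst (toℕ x ℕ.<_) (sym key-c) (ℕ.<-trans hi (ℕ.n<1+n s))))) (rot-range (Pair.within P) h₁)))
                 (CombPair.gain C f 1 h ht≤h (ℕ.≤-reflexive depth-root) λ {x} (lo , _) → ℕ.≤-reflexive
                   (depth-right (subst (ℕ._< toℕ x) (sym key-c) lo))) ⟩
          A * (1 * q₁) + A * D + (A * (1 * q₁) + A * E + α * q)
            ≡⟨ after A α q q₁ D E ⟩
          A * (2 ^ suc h₁ + (D + E)) + α * q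
            ≡⟨ cong (λ z → A * z + α * q) (sym (fork-cost within (ℕ.≤-trans (Pair.low P) ht≤h₁)
                 (ℕ.≤-trans (CombPair.low C) (subst (suc e + ht ≤_) (sym (ℕ.+-suc e h)) (s≤s (ℕ.+-monoʳ-≤ e ht≤h)))))) ⟩
          A * tree-cost T (suc h₁) + α * q ∎)
          where
          open ℕ.≤-Reasoning
          h₁ = e + suc h
          ht≤h₁ : ht ≤ h₁
          ht≤h₁ = ℕ.≤-trans ht≤h (ℕ.≤-trans (ℕ.n≤1+n h) (ℕ.m≤n+m (suc h) e))
          q = 2 ^ h
          q₁ = 2 ^ h₁
          R = 2 ^ (2 + e)
          F = sum (map f (rot (t o) h₁))
          G = sum (map f (rot (combT N t e (suc s)) h₁))
          D = tree-cost (t o) h₁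
          E = tree-cost (combT N t e (suc s)) h₁
          pow : 2 ^ suc h₁ ≡ R * q
          pow = trans (cong (λ z → 2 ^ suc z) (ℕ.+-suc e h)) (ℕ.^-distribˡ-+-* 2 (2 + e) h)
          weights : ∀ A α α′ R q S → A * S + α′ * (R * q) + α * q ≡ A * S + (α′ * R + α) * q
          weights = solve-∀
          before : ∀ A α e q R F G → A * (F + G) + (α * R + A * (3 + e)) * q
                                     ≡ A * F + A * G + α * (R * q) + A * ((3 + e) * q)
          before = solve-∀
          split : ∀ A α e q q₁ F G → A * F + A * G + α * (2 * q₁) + A * ((3 + e) * q)
                                     ≡ A * F + α * q₁ + (A * G + α * q₁ + A * ((e + 2 + 1) * q))
          split = solve-∀
          after : ∀ A α q q₁ D E → A * (1 * q₁) + A * D + (A * (1 * q₁) + A * E + α * q)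
                                   ≡ A * (2 * q₁ + (D + E)) + α * q
          after = solve-∀
        gain : ∀ h → 2 + e + ht ≤ h → Gain A α′ (nextB N b e o) T h
        gain h ht≤h with ℕ.m≤n⇒∃[o]m+o≡n ht≤h
        ... | i , refl = subst (Gain A α′ (nextB N b e o) T) (reindex e ht i) (gain′ (ht + i) (ℕ.m≤m+n ht i))
          where
          reindex : ∀ e ht i → suc (e + suc (ht + i)) ≡ 2 + e + ht + i
          reindex = solve-∀

  singleT : ℕ → Alpha n
  singleT o = tip (key o)

  singleB : ℕ → KeyTree n
  singleB o = node (leaf tt) (key o) (leaf tt)

  single : ∀ {A} o → 1 + o ≤ n → Pair A 0 0 o (1 + o) (singleT o) (singleB o)
  single o fits = record
    { within  = tip (ℕ.≤-reflexive (sym key-o)) (subst (ℕ._< suc o) (sym key-o) (ℕ.n<1+n o))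
    ; bounded = node (ℕ.≤-reflexive (sym key-o)) (subst (ℕ._< suc o) (sym key-o) (ℕ.n<1+n o)) leaf leaf
    ; low     = z≤n
    ; served  = λ h → All.replicate⁺ (2 ^ h) here
    ; gain    = λ h _ → ℕ.≤-reflexive (ℕ.+-identityʳ _)
    }
    where
    key-o : toℕ (key o) ≡ o
    key-o = toℕ-key fits

  baseT : ℕ → Alpha n
  baseT = combT 1 singleT 0

  baseB : ℕ → KeyTree n
  baseB o = node (leaf tt) (key o) (singleB (2 + o))

  -- Both tips have depth 2 in `baseT`, and `baseB` lifts one of them to the root, which saves one
  -- half per query. Having `A ≤ 2 * α` from the start later pays for the setup.
  base : ∀ {α} o → 3 + o ≤ n → Pair (2 * α) α 1 o (3 + o) (baseT o) (baseB o)
  base {α} o fits = record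
    { within  = within
    ; bounded = node (ℕ.≤-reflexive (sym key-o)) (subst (ℕ._< 3 + o) (sym key-o) (s≤s (ℕ.m≤n+m o 2))) leaf
                  (subst (λ lo → Bounded lo (3 + o) (singleB (2 + o))) (cong suc (sym key-o)) bounded)
    ; low     = low
    ; served  = λ h → All.map (λ { (inj₁ refl) → here ; (inj₂ i) → inright i }) (served h)
    ; gain    = gain′
    }
    where
    open Comb 1 singleT singleB
    open CombPair (combPair {A = 2 * α} single 0 o fits)
    key-o : toℕ (key o) ≡ o
    key-o = toℕ-key (ℕ.≤-trans (s≤s (ℕ.m≤n+m o 2)) fits)
    gain′ : ∀ h → 1 ≤ h → Gain (2 * α) α (baseB o) (baseT o) h
    gain′ (suc h) _ = ℕ.+-cancelʳ-≤ (2 * α * (1 * 2 ^ suc h)) _ _ (subst₂ _≤_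
      (left α (2 ^ h) (sum (map (depth (baseB o)) (rot (baseT o) (suc h)))))
      (right α (2 ^ h) (tree-cost (baseT o) (suc h)))
      (gain (depth (baseB o)) 1 h z≤n (ℕ.≤-reflexive depth-root)
        λ {x} (lo , _) → ℕ.≤-reflexive (depth-right (subst (ℕ._< toℕ x) (sym key-o) lo))))
      where
      left : ∀ α q S → 2 * α * S + 0 * (2 * q) + 2 * α * (3 * q) ≡ 2 * α * S + α * (2 * q) + 2 * α * (1 * (2 * q))
      left = solve-∀
      right : ∀ α q D → 2 * α * (1 * (2 * q)) + 2 * α * D + 0 * q ≡ 2 * α * D + 2 * α * (1 * (2 * q))
      right = solve-∀

  towerT : ℕ → ℕ → ℕ → Alpha n
  towerT e zero    = baseT
  towerT e (suc K) = nextT (towerSize e K) (towerT e K) e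

  towerB : ℕ → ℕ → ℕ → KeyTree n
  towerB e zero    = baseB
  towerB e (suc K) = nextB (towerSize e K) (towerB e K) e

  -- With `P = 2 ^ (2 + e)` and `A = 2 * P`, each level adds `1 + e` to `α`. The gain forgone per
  -- level is at most `P + P * (1 + e)` as long as `K ≤ P`, and the balance of `nextPair` then still
  -- has `3 * P` to spare.
  tower : ∀ e K → K ≤ 2 ^ (2 + e) → ∀ o → towerSize e K + o ≤ n →
          Pair (2 * 2 ^ (2 + e)) (2 ^ (2 + e) + K * (1 + e)) (1 + K * (2 + e)) o (towerSize e K + o) (towerT e K o) (towerB e K o)
  tower e zero    _   o fits = subst (λ α → Pair (2 * 2 ^ (2 + e)) α 1 o (3 + o) (baseT o) (baseB o))
    (sym (ℕ.+-identityʳ _)) (base o fits)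
  tower e (suc K) K<P o fits = subst (λ ht → Pair (2 * 2 ^ (2 + e)) (2 ^ (2 + e) + suc K * (1 + e)) ht o (towerSize e (suc K) + o) (towerT e (suc K) o) (towerB e (suc K) o))
    (heights e K) (Comb.nextPair (towerSize e K) (towerT e K) (towerB e K) (tower e K (ℕ.<⇒≤ K<P)) e o fits (weights e K (2 ^ (2 + e)) (ℕ.<⇒≤ K<P)))
    where
    heights : ∀ e K → 2 + e + (1 + K * (2 + e)) ≡ 1 + suc K * (2 + e)
    heights = solve-∀
    weights : ∀ e K P → K ≤ P → (P + suc K * (1 + e)) * P + (P + K * (1 + e)) ≤ (P + K * (1 + e)) * P + 2 * P * (3 + e)
    weights e K P K≤P = begin
      (P + suc K * (1 + e)) * P + (P + K * (1 + e))
        ≤⟨ ℕ.+-monoʳ-≤ ((P + suc K * (1 + e)) * P) (ℕ.+-monoʳ-≤ P (ℕ.*-monoˡ-≤ (1 + e) K≤P)) ⟩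
      (P + suc K * (1 + e)) * P + (P + P * (1 + e))
        ≤⟨ ℕ.m≤m+n _ (3 * P) ⟩
      (P + suc K * (1 + e)) * P + (P + P * (1 + e)) + 3 * P
        ≡⟨ rearrange e K P ⟩
      (P + K * (1 + e)) * P + 2 * P * (3 + e) ∎
      where
      open ℕ.≤-Reasoning
      rearrange : ∀ e K P → (P + suc K * (1 + e)) * P + (P + P * (1 + e)) + 3 * P ≡ (P + K * (1 + e)) * P + 2 * P * (3 + e)
      rearrange = solve-∀

-- Parameters

1≤⌈log₂⌉ : ∀ {n} → 2 ≤ n → 1 ≤ ⌈log₂ n ⌉
1≤⌈log₂⌉ = ⌈log₂⌉-mono-≤

n≤2^⌈log₂n⌉ : ∀ n → n ≤ 2 ^ ⌈log₂ n ⌉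
n≤2^⌈log₂n⌉ = <-rec _ go
  where
  go : ∀ n → (∀ {m} → m ℕ.< n → m ≤ 2 ^ ⌈log₂ m ⌉) → n ≤ 2 ^ ⌈log₂ n ⌉
  go 0 _ = z≤n
  go 1 _ = ℕ.m^n>0 2 ⌈log₂ 1 ⌉
  go n@(suc (suc m)) rec = begin
    n                            ≡⟨ ℕ.⌊n/2⌋+⌈n/2⌉≡n n ⟨
    ⌊ n /2⌋ + ⌈ n /2⌉            ≤⟨ ℕ.+-mono-≤ (ℕ.⌊n/2⌋≤⌈n/2⌉ n) (ℕ.≤-reflexive (sym (ℕ.+-identityʳ _))) ⟩
    2 * ⌈ n /2⌉                  ≤⟨ ℕ.*-monoʳ-≤ 2 (rec (ℕ.⌈n/2⌉<n m)) ⟩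
    2 * 2 ^ ⌈log₂ ⌈ n /2⌉ ⌉      ≡⟨ cong (λ z → 2 * 2 ^ z) (⌈log₂⌈n/2⌉⌉≡⌈log₂n⌉∸1 n) ⟩
    2 ^ suc (⌈log₂ n ⌉ ∸ 1)      ≡⟨ cong (2 ^_) (ℕ.m+[n∸m]≡n (1≤⌈log₂⌉ {n} (s≤s (s≤s z≤n)))) ⟩
    2 ^ ⌈log₂ n ⌉ ∎
    where open ℕ.≤-Reasoning

2^l<n : ∀ {n l} → l ℕ.< ⌈log₂ n ⌉ → 2 ^ l ℕ.< n
2^l<n {n} {l} l<log = ℕ.≰⇒> λ n≤2^l →
  ℕ.<⇒≱ l<log (subst (⌈log₂ n ⌉ ≤_) (⌈log₂2^n⌉≡n l) (⌈log₂⌉-mono-≤ n≤2^l))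

n<2^n : ∀ n → n ℕ.< 2 ^ n
n<2^n zero    = s≤s z≤n
n<2^n (suc n) = ℕ.+-mono-≤ (ℕ.m^n>0 2 n) (subst (suc n ≤_) (sym (ℕ.+-identityʳ _)) (n<2^n n))

⌈log₂n⌉≤n : ∀ n → ⌈log₂ n ⌉ ≤ n
⌈log₂n⌉≤n n = subst (⌈log₂ n ⌉ ≤_) (⌈log₂2^n⌉≡n n) (⌈log₂⌉-mono-≤ (ℕ.<⇒≤ (n<2^n n)))

combSize-≡ : ∀ N j → combSize N j ≡ 2 + N + j * suc N
combSize-≡ N zero    = sym (ℕ.+-identityʳ _)
combSize-≡ N (suc j) = trans (cong (suc N +_) (combSize-≡ N j)) (rearrange N j)
  where
  rearrange : ∀ N j → suc N + (2 + N + j * suc N) ≡ 2 + N + suc j * suc N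
  rearrange = solve-∀

3≤towerSize : ∀ e K → 3 ≤ towerSize e K
3≤towerSize e zero    = ℕ.≤-refl
3≤towerSize e (suc K) = ℕ.≤-trans (3≤towerSize e K) (ℕ.≤-trans (ℕ.n≤1+n _) (ℕ.m≤m+n _ _))

-- A level multiplies the size plus one by at most `3 + e ≤ 2 ^ (2 + e)`.
towerSize-bound : ∀ e K → suc (towerSize e K) ≤ 2 ^ (2 + K * (2 + e))
towerSize-bound e zero    = ℕ.≤-refl
towerSize-bound e (suc K) = begin
  suc (combSize M (suc e))           ≡⟨ cong suc (combSize-≡ M (suc e)) ⟩
  suc (2 + M + suc e * suc M)        ≡⟨ left e M ⟩
  2 + (2 + e) * suc M                ≤⟨ ℕ.+-monoˡ-≤ ((2 + e) * suc M) (ℕ.≤-trans (ℕ.≤-trans (ℕ.n≤1+n 2) (3≤towerSize e K)) (ℕ.n≤1+n M)) ⟩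
  (3 + e) * suc M                    ≤⟨ ℕ.*-mono-≤ (n<2^n (2 + e)) (towerSize-bound e K) ⟩
  2 ^ (2 + e) * 2 ^ (2 + K * (2 + e)) ≡⟨ ℕ.^-distribˡ-+-* 2 (2 + e) (2 + K * (2 + e)) ⟨
  2 ^ (2 + e + (2 + K * (2 + e)))    ≡⟨ cong (2 ^_) (right e K) ⟩
  2 ^ (2 + suc K * (2 + e)) ∎
  where
  open ℕ.≤-Reasoning
  M = towerSize e K
  left : ∀ e N → suc (2 + N + suc e * suc N) ≡ 2 + (2 + e) * suc N
  left = solve-∀
  right : ∀ e K → 2 + e + (2 + K * (2 + e)) ≡ 2 + suc K * (2 + e)
  right = solve-∀

record Parameters (n : ℕ) : Set where
  field
    e K    : ℕ
    K≤     : K ≤ 2 ^ (2 + e)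
    fits   : towerSize e K ≤ n
    height≤ : 1 + K * (2 + e) ≤ ⌈log₂ n ⌉
    -- The saving `α / A` per query is at least an eighth of lg lg n.
    gains  : ⌈log₂ ⌈log₂ n ⌉ ⌉ * (2 * 2 ^ (2 + e)) ≤ 8 * (2 ^ (2 + e) + K * (1 + e))

halve : ∀ r → ∃[ e ] 2 * e ≤ r × r ≤ 1 + 2 * e
halve zero          = 0 , z≤n , z≤n
halve (suc zero)    = 0 , z≤n , ℕ.≤-refl
halve (suc (suc r)) with halve r
... | e , p , q = suc e , subst (_≤ 2 + r) (rearrange e) (ℕ.+-monoʳ-≤ 2 p) , subst (λ z → 2 + r ≤ 1 + z) (rearrange e) (ℕ.+-monoʳ-≤ 2 q)
  where
  rearrange : ∀ e → 2 + 2 * e ≡ 2 * suc e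
  rearrange = solve-∀

small-parameters : ∀ {n} → 3 ≤ n → ⌈log₂ ⌈log₂ n ⌉ ⌉ ≤ 4 → Parameters n
small-parameters {n} 3≤n L≤4 = record
  -- The base tree alone saves one half, an eighth of 4.
  { e = 0 ; K = 0 ; K≤ = z≤n ; fits = 3≤n
  ; height≤ = 1≤⌈log₂⌉ (ℕ.≤-trans (ℕ.n≤1+n 2) 3≤n)
  ; gains = ℕ.*-monoˡ-≤ 8 L≤4
  }

large-parameters : ∀ {n r} → ⌈log₂ ⌈log₂ n ⌉ ⌉ ≡ 5 + r → Parameters n
large-parameters {n} {r} eq with halve r
-- With `e` about half of lg lg n, the full `2 ^ (2 + e)` levels have total height about
-- `2 ^ (2 + e) * (2 + e)`, still below lg n.
... | e , 2e≤r , r≤1+2e = record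
  { e = e ; K = P ; K≤ = ℕ.≤-refl
  ; fits = begin
      towerSize e P             ≤⟨ ℕ.n≤1+n _ ⟩
      suc (towerSize e P)       ≤⟨ towerSize-bound e P ⟩
      2 ^ (2 + P * (2 + e))     ≤⟨ ℕ.<⇒≤ (2^l<n {n} (ℕ.≤-trans exponent (ℕ.<⇒≤ 2^<L₁))) ⟩
      n ∎
  ; height≤ = ℕ.≤-trans (ℕ.≤-trans (ℕ.n≤1+n _) (ℕ.n≤1+n _)) (ℕ.≤-trans exponent (ℕ.<⇒≤ 2^<L₁))
  ; gains = begin
      ⌈log₂ ⌈log₂ n ⌉ ⌉ * (2 * P) ≡⟨ cong (_* (2 * P)) eq ⟩
      (5 + r) * (2 * P)           ≤⟨ ℕ.*-monoˡ-≤ (2 * P) (ℕ.+-monoʳ-≤ 5 r≤1+2e) ⟩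
      (6 + 2 * e) * (2 * P)       ≤⟨ ℕ.m≤m+n _ ((4 + 4 * e) * P) ⟩
      (6 + 2 * e) * (2 * P) + (4 + 4 * e) * P ≡⟨ rearrange e P ⟩
      8 * (P + P * (1 + e)) ∎
  }
  where
  open ℕ.≤-Reasoning
  P = 2 ^ (2 + e)
  rearrange : ∀ e P → (6 + 2 * e) * (2 * P) + (4 + 4 * e) * P ≡ 8 * (P + P * (1 + e))
  rearrange = solve-∀
  exponent : 3 + P * (2 + e) ≤ 2 ^ (4 + 2 * e)
  exponent = begin
    3 + P * (2 + e)                     ≤⟨ ℕ.+-mono-≤ (ℕ.≤-trans (s≤s (s≤s (s≤s z≤n))) (ℕ.^-monoʳ-≤ 2 {2} {3 + 2 * e} (s≤s (s≤s z≤n)))) (ℕ.*-monoʳ-≤ P (n<2^n (1 + e))) ⟩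
    2 ^ (3 + 2 * e) + P * 2 ^ (1 + e)   ≡⟨ cong (2 ^ (3 + 2 * e) +_) (trans (sym (ℕ.^-distribˡ-+-* 2 (2 + e) (1 + e))) (cong (2 ^_) (exponents e))) ⟩
    2 ^ (3 + 2 * e) + 2 ^ (3 + 2 * e)   ≡⟨ cong (2 ^ (3 + 2 * e) +_) (ℕ.+-identityʳ _) ⟨
    2 ^ (4 + 2 * e) ∎
    where
    exponents : ∀ e → 2 + e + (1 + e) ≡ 3 + 2 * e
    exponents = solve-∀
  2^<L₁ : 2 ^ (4 + 2 * e) ℕ.< ⌈log₂ n ⌉
  2^<L₁ = 2^l<n (subst (4 + 2 * e ℕ.<_) (sym eq) (ℕ.+-monoʳ-≤ 5 2e≤r))

parameters : ∀ {n} → 3 ≤ n → Parameters n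
parameters {n} 3≤n with ⌈log₂ ⌈log₂ n ⌉ ⌉ ℕ.≤? 4
... | yes L≤4 = small-parameters 3≤n L≤4
... | no  L≰4 = large-parameters (sym (ℕ.m+[n∸m]≡n (ℕ.≰⇒> L≰4)))

-- Greedy Future pays for the rotation at least as in `T`, the optimum at most as in a reshaped tree
-- with the depths of `B`, plus the setup. All terms are kept positive to avoid truncated
-- subtraction.
gap : ∀ {n A α ht hi} {T : Alpha n} {B} {T₀ : KeyTree n} → IsBST T₀ → Pair A α ht 0 hi T B →
      ∀ h → ht ≤ h → (opt : Run T₀ (fromList (setup T ++ rot T h))) → IsOptimal opt →
      A * cost opt + α * 2 ^ h ≤
      A * (suc (length (setup T)) * n) + A * cost (greedyFuture T₀ (fromList (setup T ++ rot T h)))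
gap {n} {A} {α} {T = T} {B} {T₀} bst@(o , all) pair h ht≤h opt best
  with reshape (bounded⇒Ordered (Pair.bounded pair)) o (λ {v} _ → all v)
... | B′ , ρs , same = begin
  A * cost opt + α * 2 ^ h
    ≤⟨ ℕ.+-monoˡ-≤ (α * 2 ^ h) (ℕ.*-monoʳ-≤ A (optimal-cost ρs (setup T) (rot T h) opt best)) ⟩
  A * (s + sum (map (depth B′) (rot T h))) + α * 2 ^ h
    ≡⟨ cong (λ z → A * (s + sum z) + α * 2 ^ h) (map-cong-local (All.map same (Pair.served pair h))) ⟩
  A * (s + sum (map (depth B) (rot T h))) + α * 2 ^ h
    ≡⟨ rearrange A s _ _ ⟩
  A * s + (A * sum (map (depth B) (rot T h)) + α * 2 ^ h)
    ≤⟨ ℕ.+-monoʳ-≤ (A * s) (Pair.gain pair h ht≤h) ⟩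
  A * s + A * tree-cost T h
    ≤⟨ ℕ.+-monoʳ-≤ (A * s) (ℕ.*-monoʳ-≤ A (gf-cost w bst (setup T) (rot T h)
         (fresh (steady-rot w (ℕ.≤-trans (Pair.low pair) ht≤h)) (λ {v} _ → all v) refl) (rot-∉ᶠ w h))) ⟩
  A * s + A * cost (greedyFuture T₀ (fromList (setup T ++ rot T h))) ∎
  where
  open ℕ.≤-Reasoning
  w = Pair.within pair
  s = suc (length (setup T)) * n
  rearrange : ∀ A a b c → A * (a + b) + c ≡ A * a + (A * b + c)
  rearrange = solve-∀

-- The setup uses up at most half of the gain: `A * s` is at most `2 * α` times `H / 4`. So
-- `α * H ≤ 2 * (A * D)`, and the factors 2 for `m` and 8 for `L` give 32.
extract : ∀ A α H L m s opt gf .{{_ : NonZero A}} → A * opt + α * H ≤ A * s + A * gf →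
          A ≤ 2 * α → L * A ≤ 8 * α → 4 * s ≤ H → m ≤ 2 * H → m * L ≤ 32 * (gf ∸ opt)
extract A α H L m s opt gf net A≤2α LA≤8α 4s≤H m≤2H = ℕ.*-cancelˡ-≤ A (begin
  A * (m * L)          ≡⟨ r₁ A m L ⟩
  m * (L * A)          ≤⟨ ℕ.*-mono-≤ m≤2H LA≤8α ⟩
  2 * H * (8 * α)      ≡⟨ r₂ H α ⟩
  16 * (α * H)         ≤⟨ ℕ.*-monoʳ-≤ 16 αH≤2AD ⟩
  16 * (2 * (A * D))   ≡⟨ r₃ A D ⟩
  A * (32 * D) ∎)
  where
  open ℕ.≤-Reasoning
  D = gf ∸ opt
  r₁ : ∀ A m L → A * (m * L) ≡ m * (L * A)
  r₁ = solve-∀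
  r₂ : ∀ H α → 2 * H * (8 * α) ≡ 16 * (α * H)
  r₂ = solve-∀
  r₃ : ∀ A D → 16 * (2 * (A * D)) ≡ A * (32 * D)
  r₃ = solve-∀
  αH≤As+AD : α * H ≤ A * s + A * D
  αH≤As+AD = ℕ.+-cancelˡ-≤ (A * opt) _ _ (begin
    A * opt + α * H            ≤⟨ net ⟩
    A * s + A * gf             ≤⟨ ℕ.+-monoʳ-≤ (A * s) (ℕ.*-monoʳ-≤ A (ℕ.m≤n+m∸n gf opt)) ⟩
    A * s + A * (opt + D)      ≡⟨ r A s opt D ⟩
    A * opt + (A * s + A * D) ∎)
    where
    r : ∀ A s o D → A * s + A * (o + D) ≡ A * o + (A * s + A * D)
    r = solve-∀
  αH≤2AD : α * H ≤ 2 * (A * D)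
  αH≤2AD = ℕ.*-cancelˡ-≤ 2 (ℕ.+-cancelˡ-≤ (2 * (α * H)) _ _ (begin
    2 * (α * H) + 2 * (α * H)       ≡⟨ r₄ (α * H) ⟩
    4 * (α * H)                     ≤⟨ ℕ.*-monoʳ-≤ 4 αH≤As+AD ⟩
    4 * (A * s + A * D)             ≡⟨ r₅ A s D ⟩
    A * (4 * s) + 4 * (A * D)       ≤⟨ ℕ.+-monoˡ-≤ (4 * (A * D)) (ℕ.*-mono-≤ A≤2α 4s≤H) ⟩
    2 * α * H + 4 * (A * D)         ≡⟨ r₆ α H (A * D) ⟩
    2 * (α * H) + 2 * (2 * (A * D)) ∎))
    where
    r₄ : ∀ x → 2 * x + 2 * x ≡ 4 * x
    r₄ = solve-∀
    r₅ : ∀ A s D → 4 * (A * s + A * D) ≡ A * (4 * s) + 4 * (A * D)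
    r₅ = solve-∀
    r₆ : ∀ α H x → 2 * α * H + 4 * x ≡ 2 * (α * H) + 2 * (2 * x)
    r₆ = solve-∀

m^L≤n^K : ∀ {m n} a b L K → m ≤ 2 ^ a → a * L ≤ b * K → 2 ^ b ≤ n → m ^ L ≤ n ^ K
m^L≤n^K {m} {n} a b L K m≤ aL≤bK ≤n = begin
  m ^ L         ≤⟨ ℕ.^-monoˡ-≤ L m≤ ⟩
  (2 ^ a) ^ L   ≡⟨ ℕ.^-*-assoc 2 a L ⟩
  2 ^ (a * L)   ≤⟨ ℕ.^-monoʳ-≤ 2 aL≤bK ⟩
  2 ^ (b * K)   ≡⟨ ℕ.^-*-assoc 2 b K ⟨
  (2 ^ b) ^ K   ≤⟨ ℕ.^-monoˡ-≤ K ≤n ⟩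
  n ^ K ∎
  where open ℕ.≤-Reasoning

-- The query sequence, its gap and its length

module Queries {n : ℕ} (3≤n : 3 ≤ n) (chosen : Parameters n) where

  private instance
    n≢0 : NonZero n
    n≢0 = >-nonZero (ℕ.≤-trans (s≤s z≤n) 3≤n)

  open Parameters chosen
  -- Reduction modulo `n` extends the numbering of keys to all naturals.
  open Construction {n} (_mod n) (λ i<n → trans (toℕ-fromℕ< _) (m<n⇒m%n≡m i<n))

  private
    L₁ = ⌈log₂ n ⌉
    L₂ = ⌈log₂ L₁ ⌉
    L₃ = ⌈log₂ L₂ ⌉
    -- About lg lg n / lg lg lg n; the inner `suc` keeps the divisor positive, the outer one keeps
    -- `q` positive.
    q  = suc (L₂ / suc L₃)
    -- Four times the setup cost is at most `2 ^ (3 + 3 * L₁)`, and `3 ≤ 2 * L₁` leads to the factor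
    -- 5. The factor `q` brings the length to the required order.
    h  = 5 * (L₁ * q)
    P  = 2 ^ (2 + e)
    T  = towerT e K 0
    S  = length (setup T)
    ht = 1 + K * (2 + e)

  queries : List (Fin n)
  queries = setup T ++ rot T h

  private
    2≤L₁ : 2 ≤ L₁
    2≤L₁ = ⌈log₂⌉-mono-≤ 3≤n

    L₁≤L₁q : L₁ ≤ L₁ * q
    L₁≤L₁q = ℕ.m≤m*n L₁ q

    ht≤h : ht ≤ h
    ht≤h = ℕ.≤-trans height≤ (ℕ.≤-trans L₁≤L₁q (ℕ.m≤n*m (L₁ * q) 5))

    pair : Pair (2 * P) (P + K * (1 + e)) ht 0 (towerSize e K + 0) T (towerB e K 0)
    pair = tower e K K≤ 0 (subst (_≤ n) (sym (ℕ.+-identityʳ _)) fits)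

    setup-cheap : 4 * (suc S * n) ≤ 2 ^ h
    setup-cheap = begin
      4 * (suc S * n)               ≤⟨ ℕ.*-monoʳ-≤ 4 (ℕ.*-mono-≤ (ℕ.≤-trans (ℕ.n≤1+n _) (setup-length T (Pair.low pair))) (n≤2^⌈log₂n⌉ n)) ⟩
      4 * (2 * 4 ^ ht * 2 ^ L₁)     ≤⟨ ℕ.*-monoʳ-≤ 4 (ℕ.*-monoˡ-≤ (2 ^ L₁) (ℕ.*-monoʳ-≤ 2 (ℕ.^-monoʳ-≤ 4 height≤))) ⟩
      4 * (2 * 4 ^ L₁ * 2 ^ L₁)     ≡⟨ cong (λ z → 4 * (2 * z * 2 ^ L₁)) (ℕ.^-*-assoc 2 2 L₁) ⟩
      4 * (2 * 2 ^ (2 * L₁) * 2 ^ L₁) ≡⟨ r (2 ^ (2 * L₁)) (2 ^ L₁) ⟩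
      8 * (2 ^ (2 * L₁) * 2 ^ L₁)   ≡⟨ cong (8 *_) (ℕ.^-distribˡ-+-* 2 (2 * L₁) L₁) ⟨
      8 * 2 ^ (2 * L₁ + L₁)         ≡⟨ ℕ.^-distribˡ-+-* 2 3 (2 * L₁ + L₁) ⟨
      2 ^ (3 + (2 * L₁ + L₁))       ≤⟨ ℕ.^-monoʳ-≤ 2 exponent ⟩
      2 ^ h ∎
      where
      open ℕ.≤-Reasoning
      r : ∀ x y → 4 * (2 * x * y) ≡ 8 * (x * y)
      r = solve-∀
      five : ∀ x → 2 * x + (2 * x + x) ≡ 5 * x
      five = solve-∀
      exponent : 3 + (2 * L₁ + L₁) ≤ h
      exponent = begin
        3 + (2 * L₁ + L₁)      ≤⟨ ℕ.+-monoˡ-≤ (2 * L₁ + L₁) (ℕ.≤-trans (ℕ.n≤1+n 3) (ℕ.*-monoʳ-≤ 2 2≤L₁)) ⟩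
        2 * L₁ + (2 * L₁ + L₁) ≡⟨ five L₁ ⟩
        5 * L₁                 ≤⟨ ℕ.*-monoʳ-≤ 5 L₁≤L₁q ⟩
        h ∎

    m≡ : length queries ≡ S + 2 ^ h
    m≡ = trans (length-++ (setup T)) (cong (S +_) (rot-length T (ℕ.≤-trans (Pair.low pair) ht≤h)))

    m≤ : length queries ≤ 2 * 2 ^ h
    m≤ = begin
      length queries  ≡⟨ m≡ ⟩
      S + 2 ^ h       ≤⟨ ℕ.+-monoˡ-≤ (2 ^ h) (ℕ.≤-trans (ℕ.≤-trans (ℕ.n≤1+n S) (ℕ.≤-trans (ℕ.m≤m*n (suc S) n) (ℕ.m≤n*m (suc S * n) 4))) setup-cheap) ⟩
      2 ^ h + 2 ^ h   ≡⟨ cong (2 ^ h +_) (ℕ.+-identityʳ (2 ^ h)) ⟨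
      2 * 2 ^ h ∎
      where open ℕ.≤-Reasoning

    2^h≤m : 2 ^ h ≤ length queries
    2^h≤m = subst (2 ^ h ≤_) (sym m≡) (ℕ.m≤n+m (2 ^ h) S)

    instance
      P≢0 : NonZero (2 * P)
      P≢0 = >-nonZero (ℕ.≤-trans (ℕ.m^n>0 2 (2 + e)) (ℕ.m≤n*m P 2))

  queries-nonempty : 1 ≤ length queries
  queries-nonempty = ℕ.≤-trans (ℕ.m^n>0 2 h) 2^h≤m

  queries-gap : ∀ {T₀ : KeyTree n} → IsBST T₀ → GapAtLeast 32 T₀ (fromList queries)
  queries-gap bst opt best = extract (2 * P) (P + K * (1 + e)) (2 ^ h) L₂ (length queries) (suc S * n) _ _ (gap bst pair h ht≤h opt best)
    (ℕ.*-monoʳ-≤ 2 (ℕ.m≤m+n P (K * (1 + e)))) gains setup-cheap m≤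

  queries-length : 1 ≤ L₃ → LengthBetween 2 24 n (length queries)
  queries-length 1≤L₃ =
      m^L≤n^K L₁ h L₂ (2 * L₃) (n≤2^⌈log₂n⌉ n) lower 2^h≤m
    , subst ((length queries) ^ L₃ ≤_) (trans (ℕ.^-*-assoc n 2 (12 * L₂)) (cong (n ^_) (sym (ℕ.*-assoc 2 12 L₂))))
        (m^L≤n^K (suc h) L₁ L₃ (12 * L₂) m≤ upper 2^L₁≤n²)
    where
    open ℕ.≤-Reasoning
    L₂≤q* : L₂ ≤ q * suc L₃
    L₂≤q* = begin
      L₂                                 ≡⟨ m≡m%n+[m/n]*n L₂ (suc L₃) ⟩
      L₂ % suc L₃ + L₂ / suc L₃ * suc L₃ ≤⟨ ℕ.+-monoˡ-≤ (L₂ / suc L₃ * suc L₃) (ℕ.<⇒≤ (m%n<n L₂ (suc L₃))) ⟩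
      q * suc L₃ ∎
    lower : L₁ * L₂ ≤ h * (2 * L₃)
    lower = begin
      L₁ * L₂             ≤⟨ ℕ.*-monoʳ-≤ L₁ L₂≤q* ⟩
      L₁ * (q * suc L₃)   ≤⟨ ℕ.*-monoʳ-≤ L₁ (ℕ.*-monoʳ-≤ q (ℕ.+-mono-≤ 1≤L₃ (ℕ.≤-reflexive (sym (ℕ.+-identityʳ L₃))))) ⟩
      L₁ * (q * (2 * L₃)) ≡⟨ ℕ.*-assoc L₁ q (2 * L₃) ⟨
      L₁ * q * (2 * L₃)   ≤⟨ ℕ.*-monoˡ-≤ (2 * L₃) (ℕ.m≤n*m (L₁ * q) 5) ⟩
      h * (2 * L₃) ∎
    qL₃≤2L₂ : q * L₃ ≤ 2 * L₂
    qL₃≤2L₂ = ℕ.+-mono-≤ (⌈log₂n⌉≤n L₂) (begin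
      L₂ / suc L₃ * L₃     ≤⟨ ℕ.*-monoʳ-≤ (L₂ / suc L₃) (ℕ.n≤1+n L₃) ⟩
      L₂ / suc L₃ * suc L₃ ≤⟨ m/n*n≤m L₂ (suc L₃) ⟩
      L₂                   ≡⟨ ℕ.+-identityʳ L₂ ⟨
      L₂ + 0 ∎)
    upper : suc h * L₃ ≤ L₁ * (12 * L₂)
    upper = begin
      suc h * L₃               ≤⟨ ℕ.*-monoˡ-≤ L₃ (ℕ.+-monoˡ-≤ h (ℕ.≤-trans (ℕ.≤-trans (ℕ.n≤1+n 1) 2≤L₁) L₁≤L₁q)) ⟩
      6 * (L₁ * q) * L₃        ≡⟨ r₁ L₁ q L₃ ⟩
      6 * L₁ * (q * L₃)        ≤⟨ ℕ.*-monoʳ-≤ (6 * L₁) qL₃≤2L₂ ⟩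
      6 * L₁ * (2 * L₂)        ≡⟨ r₂ L₁ L₂ ⟩
      L₁ * (12 * L₂) ∎
      where
      r₁ : ∀ a b c → 6 * (a * b) * c ≡ 6 * a * (b * c)
      r₁ = solve-∀
      r₂ : ∀ a b → 6 * a * (2 * b) ≡ a * (12 * b)
      r₂ = solve-∀
    -- Rounding the logarithm up costs less than a factor 2, and a second `n` covers it. This turns
    -- the 12 into 24.
    2^L₁≤n² : 2 ^ L₁ ≤ n ^ 2
    2^L₁≤n² = begin
      2 ^ L₁             ≡⟨ cong (2 ^_) (ℕ.m+[n∸m]≡n (ℕ.≤-trans (ℕ.n≤1+n 1) 2≤L₁)) ⟨
      2 * 2 ^ (L₁ ∸ 1)   ≤⟨ ℕ.*-mono-≤ (ℕ.≤-trans (ℕ.n≤1+n 2) 3≤n) (ℕ.<⇒≤ (2^l<n {n} (ℕ.≤-reflexive (ℕ.m+[n∸m]≡n (ℕ.≤-trans (ℕ.n≤1+n 1) 2≤L₁))))) ⟩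
      n * n              ≡⟨ cong (n *_) (ℕ.*-identityʳ n) ⟨
      n ^ 2 ∎

theorem2 : ∃[ c ] ∃[ a ] ∃[ b ] ∃[ n₀ ] (1 ≤ c) × (1 ≤ a) × (1 ≤ b) ×
    ((n : ℕ) → 2 ≤ n → (T₀ : KeyTree n) → IsBST T₀ →
    (∃[ m ] Σ (Vec (Fin n) m) λ X → (1 ≤ m) × GapAtLeast c T₀ X) ×
    (n₀ ≤ n → ∃[ m ] Σ (Vec (Fin n) m) λ X →
    (1 ≤ m) × GapAtLeast c T₀ X × LengthBetween a b n m))
theorem2 = 32 , 2 , 24 , 5 , s≤s z≤n , s≤s z≤n , s≤s z≤n , λ n 2≤n T₀ bst → any n 2≤n T₀ bst , long n T₀ bst
  where
  any : (n : ℕ) → 2 ≤ n → (T₀ : KeyTree n) → IsBST T₀ → ∃[ m ] Σ (Vec (Fin n) m) λ X → (1 ≤ m) × GapAtLeast 32 T₀ X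
  -- Here lg lg n is 0, so any single query will do.
  any 2 _ T₀ bst = 1 , zero ∷ [] , s≤s z≤n , λ _ _ → z≤n
  any (suc (suc (suc n))) _ T₀ bst = _ , fromList queries , queries-nonempty , queries-gap bst
    where
    3≤n : 3 ≤ 3 + n
    3≤n = s≤s (s≤s (s≤s z≤n))
    open Queries 3≤n (parameters 3≤n)
  any 1 (s≤s ())
  long : (n : ℕ) (T₀ : KeyTree n) → IsBST T₀ → 5 ≤ n → ∃[ m ] Σ (Vec (Fin n) m) λ X →
         (1 ≤ m) × GapAtLeast 32 T₀ X × LengthBetween 2 24 n m
  long n T₀ bst 5≤n = _ , fromList queries , queries-nonempty , queries-gap bst , queries-length
    -- From 5 on the three rounded logarithms are at least 3, 2 and 1, whence the threshold 5.
    (⌈log₂⌉-mono-≤ {2} (⌈log₂⌉-mono-≤ {3} (⌈log₂⌉-mono-≤ 5≤n)))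
    where
    3≤n : 3 ≤ n
    3≤n = ℕ.≤-trans (s≤s (s≤s (s≤s z≤n))) 5≤n
    open Queries 3≤n (parameters 3≤n)
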